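{- For even $n\ge 2$ and every $c\in\{0,1,\ldots,n-2\}$, we have $|\mathcal{W}_{n,c}|=N_1(n,|c|+1)/2$.
   Context: Fix an integer $n\ge 2$ and place $2n$ points equidistantly on the unit circle, labeled $1,2,\ldots,2n$ in clockwise order. $\mathcal{M}_n$ is the set of all non-crossing straight-line perfect matchings on these points. For $M\in\mathcal{M}_n$ and $e\in M$, the length $\ell(e)$ is the minimum, over the two sides of the line through $e$, of the number of other edges of $M$ lying on that side; $e$ is a perimeter edge if $\ell(e)=0$. Write the endpoints of $e$ as $i,j$ such that the circle center lies to the right of the ray from $i$ to $j$; the sign of $e$ is $\mathrm{sgn}(e)=+1$ if $i$ is odd and $-1$ if $i$ is even ($e$ is positive resp. negative). The weight of $M$ is $w(M)=\sum_{e\in M}\mathrm{sgn}(e)\,\ell(e)$. For a nonzero integer $c$ with $|c|\le n-2$, $\mathcal{W}_{n,c}$ is the set of matchings in $\mathcal{M}_n$ with weight exactly $c$; for $c=0$, $\mathcal{W}_{n,0}:=\{M_0\}$, where $M_0$ is the matching consisting only of perimeter edges, all of them positive. The generalized Narayana numbers are $N_r(n,k)=\frac{r+1}{n+1}\binom{n+1}{k}\binom{n-r-1}{k-1}$ for integers $n\ge 1$, $r\ge 0$, $1\le k\le n-r$. -}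

module Defs where

open import Data.Nat as ℕ using (ℕ; zero; suc; _+_; _*_; _∸_; _≤ᵇ_; _<ᵇ_; _≡ᵇ_; _⊓_; _%_)
open import Data.Nat.Combinatorics using (_C_)
open import Data.Bool using (Bool; true; false; _∧_; _∨_; not; if_then_else_)
open import Data.Fin using (Fin; toℕ)
open import Data.Vec using (Vec; lookup)
open import Data.List using (List; filterᵇ; length; foldr; map; allFin)
open import Data.Bool.ListAction using (and)
open import Data.Integer as ℤ using (ℤ; +_; -[1+_])
open import Data.Rational as ℚ using (ℚ)
open import Relation.Nullary.Decidable using (does)

-- Points 1,…,2n on the circle (clockwise) are represented by Fin (2n):
-- the element x : Fin (2n) stands for the point with label (toℕ x + 1).
-- A (candidate) matching is given by its partner map, stored as a vector:
-- v : Vec (Fin m) m, the partner of x is  lookup v x.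

Matching : ℕ → Set
Matching m = Vec (Fin m) m

_==_ : ∀ {m} → Fin m → Fin m → Bool
x == y = toℕ x ≡ᵇ toℕ y

_<F_ : ∀ {m} → Fin m → Fin m → Bool
x <F y = toℕ x <ᵇ toℕ y

allᶠ : ∀ {m} → (Fin m → Bool) → Bool
allᶠ {m} p = and (map p (allFin m))

countᶠ : ∀ {m} → (Fin m → Bool) → ℕ
countᶠ {m} p = length (filterᵇ p (allFin m))

sumℤ : ∀ {m} → (Fin m → ℤ) → ℤ
sumℤ {m} f = foldr ℤ._+_ (+ 0) (map f (allFin m))

module _ {m : ℕ} (v : Matching m) where

  partner : Fin m → Fin m
  partner x = lookup v x

  isPerfectMatching : Bool
  isPerfectMatching = allᶠ (λ x → (partner (partner x) == x) ∧ not (partner x == x))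

  -- straight-line chords between points in convex position cross iff their
  -- endpoints interleave: a < c < b < d for chords {a,b}, {c,d}
  isNonCrossing : Bool
  isNonCrossing = allᶠ (λ x → allᶠ (λ y →
    not ((x <F y) ∧ (y <F partner x) ∧ (partner x <F partner y))))

  cwGap : Fin m → Fin m → ℕ
  cwGap x y = if toℕ x ≤ᵇ toℕ y then toℕ y ∸ toℕ x else (m + toℕ y) ∸ toℕ x

  -- z lies strictly on the arc going clockwise from s to t,
  -- i.e. strictly on that side of the line through s and t
  onArc : Fin m → Fin m → Fin m → Bool
  onArc s t z = (0 <ᵇ cwGap s z) ∧ (cwGap s z <ᵇ cwGap s t)

  -- number of edges of the matching lying (both endpoints) strictly on the
  -- clockwise side from s to t; each edge {y, partner y} counted once (y < partner y)
  edgesOnSide : Fin m → Fin m → ℕ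
  edgesOnSide s t = countᶠ (λ y → (y <F partner y) ∧ onArc s t y ∧ onArc s t (partner y))

  len : Fin m → ℕ
  len x = edgesOnSide x (partner x) ⊓ edgesOnSide (partner x) x

-- The circle center lies strictly to the right of the ray from i to j
-- (2n points, clockwise order) iff j is reached from i clockwise in fewer than n steps.
centerRight : ∀ n → Matching (2 * n) → Fin (2 * n) → Bool
centerRight n v x = cwGap v x (partner v x) <ᵇ n

-- sign of an edge oriented i → j (centre to the right): +1 iff label of i is odd,
-- i.e. iff toℕ i is even
sgn : ∀ {m} → Fin m → ℤ
sgn i = if toℕ i % 2 ≡ᵇ 0 then + 1 else -[1+ 0 ]

-- weight: each edge counted once, via its orientation i → partner i with the
-- centre on the right
weight : ∀ n → Matching (2 * n) → ℤ
weight n v = sumℤ (λ x → if centerRight n v x then sgn x ℤ.* (+ len v x) else + 0)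

-- v is M₀: every edge is a perimeter edge and positive
isM₀ : ∀ n → Matching (2 * n) → Bool
isM₀ n v = allᶠ (λ x → not (centerRight n v x) ∨ ((len v x ≡ᵇ 0) ∧ (toℕ x % 2 ≡ᵇ 0)))

isW : ∀ n → ℕ → Matching (2 * n) → Bool
isW n c v = isPerfectMatching v ∧ isNonCrossing v ∧
  (if c ≡ᵇ 0 then isM₀ n v else does (weight n v ℤ.≟ + c))

N : ℕ → ℕ → ℕ → ℚ
N r n k = ((+ (suc r)) ℚ./ (suc n)) ℚ.* ((+ ((suc n C k) * ((n ∸ r ∸ 1) C (k ∸ 1)))) ℚ./ 1)

{-# OPTIONS --safe #-}
-- A non-crossing matching is cut open at the first point and read as a bracket
-- word, i.e. a binary tree (node l r) = "( l ) r". Let b be the number of edges whose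
-- left end has odd index and let L be the number of long edges, those enclosing at
-- least half of the points. Interchanging the order of summation in the weight, and
-- using that nested long edges alternate in sign, gives
-- weight = b - (n - 1) [L odd]. Hence W(n,c) consists of the matchings with b = c and
-- L even, and M₀ is the only such matching for c = 0.
--
-- The swap (node l r) ↦ (node r l), which exchanges odd and even edges up to the root
-- edge, yields a b-preserving bijection from the matchings with L odd to those whose
-- first edge is long. Comparing the matchings with a long and with a short first edge
-- by a second such exchange gives 2 |W(n,c)| + T(n-1,c-1) = T(n,c) + T(n-1,c), where
-- T(n,c) counts the matchings with b = c. Finally
-- T(n+1,c) = C(n,c)² - C(n,c-1) C(n,c+1) by the reflection principle.
module Submission where

open import Defs
open import Data.Bool using (Bool; true; false; not; T; _∧_; _∨_; if_then_else_)
open import Data.Bool.ListAction using (and)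
open import Data.Bool.Properties using (T-irrelevant; not-involutive; T-≡; T-∧; ∧-identityʳ; ∧-zeroʳ)
open import Data.Empty using (⊥; ⊥-elim)
open import Data.Fin using (Fin; zero; suc; toℕ; fromℕ<)
open import Data.Fin.Permutation using (↔⇒≡)
open import Data.Fin.Properties using (+↔⊎; toℕ-injective; toℕ<n; toℕ-fromℕ<)
open import Data.Integer as ℤ using (ℤ; +_; -[1+_])
import Data.Integer.Properties as ℤₚ
import Data.Integer.Tactic.RingSolver as ℤ-Solver
open import Data.List using (filterᵇ; length; foldr)
import Data.List as List
open import Data.List.Properties using (map-tabulate)
open import Data.Nat using (ℕ; zero; suc; _+_; _*_; _∸_; _≤_; _<_; z≤n; s≤s; _≤ᵇ_; _<ᵇ_; _≡ᵇ_; _⊓_; _%_; _<?_; _≟_)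
open import Data.Nat.Combinatorics using (_C_; nCk+nC[k+1]≡[n+1]C[k+1]; nCk≡nC[n∸k]; k>n⇒nCk≡0; nCn≡1)
open import Data.Nat.Divisibility using (_∣_; divides)
open import Data.Nat.Properties hiding (≡-irrelevant)
import Data.Nat.Tactic.RingSolver as ℕ-Solver
open import Data.Product using (Σ; ∃; ∃₂; _×_; _,_; proj₁; proj₂)
open import Data.Rational using (_/_; ½) renaming (_*_ to _*ℚ_)
import Data.Rational as ℚ
import Data.Rational.Properties as ℚₚ
open import Data.Rational.Unnormalised as ℚᵘ using (mkℚᵘ; *≡*)
import Data.Rational.Unnormalised.Properties as ℚᵘₚ
open import Data.Sum using (_⊎_; inj₁; inj₂)
open import Data.Sum.Function.Propositional using (_⊎-↔_)
open import Data.Unit using (⊤; tt)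
open import Data.Vec using (Vec; []; _∷_; lookup; tabulate)
open import Data.Vec.Properties using (lookup∘tabulate)
open import Function.Base using (_∘_; id; case_of_)
open import Function.Bundles using (_↔_; mk↔ₛ′; Inverse; Equivalence)
open import Function.Properties.Inverse using (↔-sym; ↔-trans)
open import Relation.Binary.Definitions using (tri<; tri≈; tri>)
open import Relation.Binary.PropositionalEquality using (_≡_; _≢_; refl; sym; ≢-sym; trans; cong; cong₂; subst; subst₂; module ≡-Reasoning)
open import Relation.Binary.PropositionalEquality.WithK using (≡-irrelevant)
open import Relation.Nullary using (¬_; Dec; yes; no; Irrelevant; does; contradiction)
open import Relation.Nullary.Decidable using (dec-true; dec-false)

-- Finite cardinalities

-- Evenness of `n` enters twice, with `K = n / 2`. An edge enclosing `k` edges spans `2k + 1` steps,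
-- which is never `n`, so no edge passes through the centre. And the two subtrees of the root have
-- `n - 1` nodes together, an odd number, so exactly one of them has at least `K`; this pairs trees
-- with a long first edge with trees with a short one.
--
-- Moving a nonempty subtree to a start of the other parity and swapping it changes its number of
-- odd edges by exactly one. Each exchange balances such a change against another one. A leaf does
-- not obey the rule, and the leaf cases left out by the second exchange are the terms T(n-1,c) and
-- T(n-1,c-1).
--
-- The value c = 0 is special because weight 0 is also attained by the perimeter matching with all
-- signs negative, which has b = n - 1 and L = 1.

×-irrelevant : {A B : Set} → Irrelevant A → Irrelevant B → Irrelevant (A × B)
×-irrelevant irrA irrB (a , b) (a′ , b′) = cong₂ _,_ (irrA a a′) (irrB b b′)

Σ-≡ : {A : Set} {P : A → Set} → (∀ a → Irrelevant (P a)) →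
      {x y : Σ A P} → proj₁ x ≡ proj₁ y → x ≡ y
Σ-≡ irr {a , p} {.a , q} refl = cong (a ,_) (irr a p q)

-- Uniqueness on both sides makes the functions extracted from `toB` and `toA` mutually inverse,
-- whatever recursion produced them. A construction by recursion on a size bound can thus be
-- inverted without unfolding it.
relation-↔ : {A B : Set} {P : A → Set} {Q : B → Set} (R : A → B → Set) →
  (∀ a → Irrelevant (P a)) → (∀ b → Irrelevant (Q b)) →
  (∀ a → P a → Σ B λ b → Q b × R a b) →
  (∀ b → Q b → Σ A λ a → P a × R a b) →
  (∀ a b b′ → Q b → Q b′ → R a b → R a b′ → b ≡ b′) →
  (∀ a a′ b → P a → P a′ → R a b → R a′ b → a ≡ a′) →
  Σ A P ↔ Σ B Q
relation-↔ {A} {B} {P} {Q} R irrP irrQ toB toA uniqB uniqA = mk↔ₛ′ to from to-from from-to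
  where
  to : Σ A P → Σ B Q
  to (a , p) = let b , q , _ = toB a p in b , q

  from : Σ B Q → Σ A P
  from (b , q) = let a , p , _ = toA b q in a , p

  to-from : ∀ y → to (from y) ≡ y
  to-from (b , q) =
    let a , p , r = toA b q ; b′ , q′ , r′ = toB a p
    in Σ-≡ irrQ (uniqB a b′ b q′ q r′ r)

  from-to : ∀ x → from (to x) ≡ x
  from-to (a , p) =
    let b , q , r = toB a p ; a′ , p′ , r′ = toA b q
    in Σ-≡ irrP (uniqA a′ a b p′ p r′ r)

restrict-↔ : {A B : Set} {P : A → Set} {Q : B → Set} →
  (∀ a → Irrelevant (P a)) → (∀ b → Irrelevant (Q b)) →
  (f : A → B) (g : B → A) →
  (∀ a → P a → Q (f a)) → (∀ b → Q b → P (g b)) →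
  (∀ b → Q b → f (g b) ≡ b) → (∀ a → P a → g (f a) ≡ a) →
  Σ A P ↔ Σ B Q
restrict-↔ irrP irrQ f g P⇒Q Q⇒P fg gf = mk↔ₛ′
  (λ (a , p) → f a , P⇒Q a p) (λ (b , q) → g b , Q⇒P b q)
  (λ (b , q) → Σ-≡ irrQ (fg b q)) (λ (a , p) → Σ-≡ irrP (gf a p))

same-↔ : {A : Set} {P Q : A → Set} →
  (∀ a → Irrelevant (P a)) → (∀ a → Irrelevant (Q a)) →
  (∀ a → P a → Q a) → (∀ a → Q a → P a) → Σ A P ↔ Σ A Q
same-↔ irrP irrQ P⇒Q Q⇒P = restrict-↔ irrP irrQ id id P⇒Q Q⇒P (λ _ _ → refl) (λ _ _ → refl)

infix 0 _HasSize_
_HasSize_ : Set → ℕ → Set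
A HasSize k = Fin k ↔ A

HasSize-unique : {A : Set} {j k : ℕ} → A HasSize j → A HasSize k → j ≡ k
HasSize-unique f g = ↔⇒≡ (↔-trans f (↔-sym g))

HasSize-⊎ : {A B : Set} {j k : ℕ} → A HasSize j → B HasSize k → A ⊎ B HasSize j + k
HasSize-⊎ f g = ↔-trans +↔⊎ (f ⊎-↔ g)

empty-HasSize : {A : Set} → ¬ A → A HasSize 0
empty-HasSize ¬a = mk↔ₛ′ (λ ()) (λ a → ⊥-elim (¬a a)) (λ a → ⊥-elim (¬a a)) (λ ())

singleton-HasSize : {A : Set} (a : A) → (∀ b → a ≡ b) → A HasSize 1
singleton-HasSize a unique = mk↔ₛ′ (λ _ → a) (λ _ → zero) unique (λ { zero → refl })

filter-↔ : {A : Set} {P : A → Set} → (∀ a → Irrelevant (P a)) → (q : A → Bool) →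
  Σ A P ↔ (Σ A (λ a → P a × q a ≡ true) ⊎ Σ A (λ a → P a × q a ≡ false))
filter-↔ {A} {P} irr q = mk↔ₛ′ (λ (a , p) → split a p (q a) refl) join to-from from-to
  where
  Split = Σ A (λ a → P a × q a ≡ true) ⊎ Σ A (λ a → P a × q a ≡ false)

  split : ∀ a → P a → ∀ b → q a ≡ b → Split
  split a p true  eq = inj₁ (a , p , eq)
  split a p false eq = inj₂ (a , p , eq)

  join : Split → Σ A P
  join (inj₁ (a , p , _)) = a , p
  join (inj₂ (a , p , _)) = a , p

  to-from : ∀ s → split (proj₁ (join s)) (proj₂ (join s)) (q (proj₁ (join s))) refl ≡ s
  to-from (inj₁ (a , p , eq)) = lemma (q a) refl eq
    where
    lemma : ∀ b (e : q a ≡ b) → b ≡ true → split a p b e ≡ inj₁ (a , p , eq)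
    lemma true e refl = cong (λ e′ → inj₁ (a , p , e′)) (≡-irrelevant e eq)
  to-from (inj₂ (a , p , eq)) = lemma (q a) refl eq
    where
    lemma : ∀ b (e : q a ≡ b) → b ≡ false → split a p b e ≡ inj₂ (a , p , eq)
    lemma false e refl = cong (λ e′ → inj₂ (a , p , e′)) (≡-irrelevant e eq)

  from-to : ∀ x → join (split (proj₁ x) (proj₂ x) (q (proj₁ x)) refl) ≡ x
  from-to (a , p) = lemma (q a) refl
    where
    lemma : ∀ b (e : q a ≡ b) → join (split a p b e) ≡ (a , p)
    lemma true  e = refl
    lemma false e = refl

Fin-filter : ∀ k (q : Fin k → Bool) → ∃ λ i → Σ (Fin k) (λ x → q x ≡ true) HasSize i
Fin-filter zero    q = 0 , empty-HasSize λ ()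
Fin-filter (suc k) q with Fin-filter k (q ∘ suc) | q zero in q0
... | i , size | false = i , ↔-trans size (mk↔ₛ′ (λ (x , e) → suc x , e) from to-from (λ _ → refl))
  where
  from : Σ (Fin (suc k)) (λ x → q x ≡ true) → Σ (Fin k) (λ x → q (suc x) ≡ true)
  from (zero  , e) = case trans (sym e) q0 of λ ()
  from (suc x , e) = x , e

  to-from : ∀ y → (suc (proj₁ (from y)) , proj₂ (from y)) ≡ y
  to-from (zero  , e) = case trans (sym e) q0 of λ ()
  to-from (suc x , e) = refl
... | i , size | true = suc i , ↔-trans (HasSize-⊎ (singleton-HasSize tt λ _ → refl) size)
                                        (mk↔ₛ′ to from to-from from-to)
  where
  to : ⊤ ⊎ Σ (Fin k) (λ x → q (suc x) ≡ true) → Σ (Fin (suc k)) (λ x → q x ≡ true)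
  to (inj₁ _)       = zero , q0
  to (inj₂ (x , e)) = suc x , e

  from : Σ (Fin (suc k)) (λ x → q x ≡ true) → ⊤ ⊎ Σ (Fin k) (λ x → q (suc x) ≡ true)
  from (zero  , e) = inj₁ tt
  from (suc x , e) = inj₂ (x , e)

  to-from : ∀ y → to (from y) ≡ y
  to-from (zero  , e) = cong (zero ,_) (≡-irrelevant q0 e)
  to-from (suc x , e) = refl

  from-to : ∀ y → from (to y) ≡ y
  from-to (inj₁ _) = refl
  from-to (inj₂ _) = refl

filter-HasSize : {A : Set} {P : A → Set} {k : ℕ} → (∀ a → Irrelevant (P a)) →
  Σ A P HasSize k → (q : A → Bool) → ∃ λ i → Σ A (λ a → P a × q a ≡ true) HasSize i
filter-HasSize {A} {P} {k} irr f q = i , ↔-trans size (mk↔ₛ′ to from to-from from-to)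
  where
  open Inverse f using () renaming (to to f⁺; from to f⁻; strictlyInverseˡ to f⁺f⁻; strictlyInverseʳ to f⁻f⁺)

  i = proj₁ (Fin-filter k (q ∘ proj₁ ∘ f⁺))
  size = proj₂ (Fin-filter k (q ∘ proj₁ ∘ f⁺))

  to : Σ (Fin k) (λ x → q (proj₁ (f⁺ x)) ≡ true) → Σ A (λ a → P a × q a ≡ true)
  to (x , e) = proj₁ (f⁺ x) , proj₂ (f⁺ x) , e

  from : Σ A (λ a → P a × q a ≡ true) → Σ (Fin k) (λ x → q (proj₁ (f⁺ x)) ≡ true)
  from (a , p , e) = f⁻ (a , p) , trans (cong (q ∘ proj₁) (f⁺f⁻ (a , p))) e

  to-from : ∀ y → to (from y) ≡ y
  to-from (a , p , e) = Σ-≡ (λ a → ×-irrelevant (irr a) ≡-irrelevant) (cong proj₁ (f⁺f⁻ (a , p)))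

  from-to : ∀ y → from (to y) ≡ y
  from-to (x , e) = Σ-≡ (λ _ → ≡-irrelevant) (f⁻f⁺ x)

not-true⇒false : ∀ {b} → not b ≡ true → b ≡ false
not-true⇒false {false} _ = refl

-- Allows counting by subtraction: the two parts of a finite type receive sizes without being
-- enumerated.
split-HasSize : {A : Set} {P : A → Set} {k : ℕ} → (∀ a → Irrelevant (P a)) →
  Σ A P HasSize k → (q : A → Bool) → ∃₂ λ i j →
  (Σ A (λ a → P a × q a ≡ true) HasSize i) × (Σ A (λ a → P a × q a ≡ false) HasSize j) × i + j ≡ k
split-HasSize irr f q =
  let i , size-i = filter-HasSize irr f q
      j , size-j = filter-HasSize irr f (not ∘ q)
      size-j′ = ↔-trans size-j (same-↔ (λ a → ×-irrelevant (irr a) ≡-irrelevant)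
                                       (λ a → ×-irrelevant (irr a) ≡-irrelevant)
                                       (λ a (p , e) → p , not-true⇒false e)
                                       (λ a (p , e) → p , cong not e))
  in i , j , size-i , size-j′ ,
     HasSize-unique (↔-trans (HasSize-⊎ size-i size-j′) (↔-sym (filter-↔ irr q))) f

-- Trees and their long edges

≤ᵇ-true : ∀ {m n} → m ≤ n → (m ≤ᵇ n) ≡ true
≤ᵇ-true m≤n = Equivalence.to T-≡ (≤⇒≤ᵇ m≤n)

≤ᵇ-true⁻¹ : ∀ m n → (m ≤ᵇ n) ≡ true → m ≤ n
≤ᵇ-true⁻¹ m n e = ≤ᵇ⇒≤ m n (Equivalence.from T-≡ e)

≤ᵇ-false : ∀ {m n} → n < m → (m ≤ᵇ n) ≡ false
≤ᵇ-false {m} {n} n<m with m ≤ᵇ n in e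
... | true  = contradiction (≤ᵇ-true⁻¹ m n e) (<⇒≱ n<m)
... | false = refl

≤ᵇ-false⁻¹ : ∀ m n → (m ≤ᵇ n) ≡ false → n < m
≤ᵇ-false⁻¹ m n e = ≰⇒> λ m≤n → case trans (sym e) (≤ᵇ-true m≤n) of λ ()

-- (node l r) is the bracket word "( l ) r"; its nodes are the edges of a
-- non-crossing matching of consecutive points.
data Tree : Set where
  leaf : Tree
  node : Tree → Tree → Tree

size : Tree → ℕ
size leaf       = 0
size (node l r) = suc (size l + size r)

bit : Bool → ℕ
bit false = 0
bit true  = 1

-- The number of edges whose left end sits at an odd position, where p says
-- whether the word starts at an odd position.
oddEdges : Bool → Tree → ℕ
oddEdges p leaf       = 0
oddEdges p (node l r) = bit p + (oddEdges (not p) l + oddEdges p r)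

oddEdges≤size : ∀ p t → oddEdges p t ≤ size t
oddEdges≤size p leaf       = z≤n
oddEdges≤size p (node l r) =
  +-mono-≤ (bit≤1 p) (+-mono-≤ (oddEdges≤size (not p) l) (oddEdges≤size p r))
  where
  bit≤1 : ∀ b → bit b ≤ 1
  bit≤1 false = z≤n
  bit≤1 true  = ≤-refl

isLeaf : Tree → Bool
isLeaf leaf       = true
isLeaf (node _ _) = false

swap : Tree → Tree
swap leaf       = leaf
swap (node l r) = node r l

swap-involutive : ∀ t → swap (swap t) ≡ t
swap-involutive leaf       = refl
swap-involutive (node l r) = refl

swap-injective : ∀ {s t} → swap s ≡ swap t → s ≡ t
swap-injective {s} {t} e = trans (sym (swap-involutive s)) (trans (cong swap e) (swap-involutive t))

size-swap : ∀ t → size (swap t) ≡ size t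
size-swap leaf       = refl
size-swap (node l r) = cong suc (+-comm (size r) (size l))

isLeaf-swap : ∀ t → isLeaf (swap t) ≡ isLeaf t
isLeaf-swap leaf       = refl
isLeaf-swap (node l r) = refl

nonLeaf : ∀ {k} t → suc k ≤ size t → isLeaf t ≡ false
nonLeaf (node l r) _ = refl

-- This is the symmetry of the Narayana numbers.
oddEdges-swap : ∀ t → isLeaf t ≡ false → oddEdges true t ≡ suc (oddEdges false (swap t))
oddEdges-swap (node l r) _ = cong suc (+-comm (oddEdges false l) (oddEdges true r))

oddEdges-swap′ : ∀ t → isLeaf t ≡ false → oddEdges true (swap t) ≡ suc (oddEdges false t)
oddEdges-swap′ (node l r) _ = cong suc (+-comm (oddEdges false r) (oddEdges true l))

module Long (K : ℕ) (0<K : 0 < K) where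

  -- An edge (node l r) is long when K ≤ size l. In a tree of size at most 2 * K
  -- the long edges form a chain of nested edges; longOdd is the parity of its length.
  longOdd : Tree → Bool
  longOdd leaf       = false
  longOdd (node l r) = if K ≤ᵇ size l then not (longOdd l) else longOdd r

  firstLong : Tree → Bool
  firstLong leaf       = false
  firstLong (node l r) = K ≤ᵇ size l

  longOdd-long : ∀ l r → K ≤ size l → longOdd (node l r) ≡ not (longOdd l)
  longOdd-long l r K≤l rewrite ≤ᵇ-true K≤l = refl

  longOdd-short : ∀ l r → size l < K → longOdd (node l r) ≡ longOdd r
  longOdd-short l r l<K rewrite ≤ᵇ-false l<K = refl

  -- A size- and oddEdges-preserving correspondence between the trees with an odd
  -- number of long edges and the trees whose first edge is long.
  infix 4 _~_
  data _~_ : Tree → Tree → Set where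
    same  : ∀ {l r} → K ≤ size l → longOdd l ≡ false → node l r ~ node l r
    -- The long edge found in `r` is carried to the front, and its interior `l₂`, swapped, is
    -- combined with `l` inside it. The last premise uses the correspondence backwards, so `l′` has
    -- an odd number of long edges and the image an even number; it never coincides with an image
    -- under `same`.
    shift : ∀ {l r l′ l₂ r₂} → size l < K → r ~ node l₂ r₂ → l′ ~ node (swap l₂) l →
            node l r ~ node l′ r₂

  ~-longOdd : ∀ {t u} → t ~ u → longOdd t ≡ true
  ~-longOdd (same {l} {r} K≤l e)     = trans (longOdd-long l r K≤l) (cong not e)
  ~-longOdd (shift {l} {r} l<K p q) = trans (longOdd-short l r l<K) (~-longOdd p)

  ~-size : ∀ {t u} → t ~ u → size t ≡ size u
  ~-size (same _ _) = refl
  ~-size (shift {l} {r} {l′} {l₂} {r₂} _ p q) = cong suc (begin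
    size l + size r                        ≡⟨ cong (λ x → size l + x) (~-size p) ⟩
    size l + suc (size l₂ + size r₂)       ≡⟨ arith (size l) (size l₂) (size r₂) ⟩
    suc (size l₂ + size l) + size r₂       ≡⟨ cong (λ x → suc (x + size l) + size r₂) (size-swap l₂) ⟨
    suc (size (swap l₂) + size l) + size r₂ ≡⟨ cong (_+ size r₂) (~-size q) ⟨
    size l′ + size r₂                      ∎)
    where
    open ≡-Reasoning
    arith : ∀ a b c → a + suc (b + c) ≡ suc (b + a) + c
    arith = ℕ-Solver.solve-∀

  ~-firstLong : ∀ {t u} → t ~ u → firstLong u ≡ true
  ~-firstLong (same K≤l _) = ≤ᵇ-true K≤l
  ~-firstLong (shift {l} {l′ = l′} {l₂ = l₂} _ p q) = ≤ᵇ-true (begin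
    K                             ≤⟨ ≤ᵇ-true⁻¹ K (size l₂) (~-firstLong p) ⟩
    size l₂                       ≡⟨ size-swap l₂ ⟨
    size (swap l₂)                ≤⟨ m≤n⇒m≤1+n (m≤m+n _ _) ⟩
    suc (size (swap l₂) + size l) ≡⟨ ~-size q ⟨
    size l′                       ∎)
    where open ≤-Reasoning

  -- In `shift` the edge of `node l₂ r₂` is replaced by one of the other parity, and `l₂` also
  -- changes the parity of its start. Swapping `l₂` makes the second change cancel the first; `l₂`
  -- is nonempty because it has at least `K` nodes.
  ~-oddEdges : ∀ {t u} p → t ~ u → oddEdges p t ≡ oddEdges p u
  ~-oddEdges _ (same _ _) = refl
  ~-oddEdges p (shift {l} {r} {l′} {l₂} {r₂} _ s q) = go p
    where
    open ≡-Reasoning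
    nl : isLeaf l₂ ≡ false
    nl = nonLeaf l₂ (≤-trans 0<K (≤ᵇ-true⁻¹ K (size l₂) (~-firstLong s)))

    arith : ∀ a b c → a + (suc b + c) ≡ suc (b + a) + c
    arith = ℕ-Solver.solve-∀

    arith′ : ∀ a b c → a + suc (b + c) ≡ (suc b + a) + c
    arith′ = ℕ-Solver.solve-∀

    go : ∀ p → oddEdges p (node l r) ≡ oddEdges p (node l′ r₂)
    go false = begin
      oddEdges true l + oddEdges false r
        ≡⟨ cong (λ x → oddEdges true l + x) (~-oddEdges false s) ⟩
      oddEdges true l + (oddEdges true l₂ + oddEdges false r₂)
        ≡⟨ cong (λ x → oddEdges true l + (x + oddEdges false r₂)) (oddEdges-swap l₂ nl) ⟩
      oddEdges true l + (suc (oddEdges false (swap l₂)) + oddEdges false r₂)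
        ≡⟨ arith (oddEdges true l) (oddEdges false (swap l₂)) (oddEdges false r₂) ⟩
      suc (oddEdges false (swap l₂) + oddEdges true l) + oddEdges false r₂
        ≡⟨ cong (_+ oddEdges false r₂) (~-oddEdges true q) ⟨
      oddEdges true l′ + oddEdges false r₂ ∎
    go true = cong suc (begin
      oddEdges false l + oddEdges true r
        ≡⟨ cong (λ x → oddEdges false l + x) (~-oddEdges true s) ⟩
      oddEdges false l + suc (oddEdges false l₂ + oddEdges true r₂)
        ≡⟨ arith′ (oddEdges false l) (oddEdges false l₂) (oddEdges true r₂) ⟩
      (suc (oddEdges false l₂) + oddEdges false l) + oddEdges true r₂
        ≡⟨ cong (λ x → (x + oddEdges false l) + oddEdges true r₂) (oddEdges-swap′ l₂ nl) ⟨
      (oddEdges true (swap l₂) + oddEdges false l) + oddEdges true r₂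
        ≡⟨ cong (_+ oddEdges true r₂) (~-oddEdges false q) ⟨
      oddEdges false l′ + oddEdges true r₂ ∎)

  -- The two statements are proved together because `shift` uses the relation once in each
  -- direction. `same` and `shift` cannot share a source, by the size of the left subtree, nor a
  -- target, by the parity of its long edges.
  ~-functional : ∀ {t u u′} → t ~ u → t ~ u′ → u ≡ u′
  ~-injective  : ∀ {t t′ u} → t ~ u → t′ ~ u → t ≡ t′

  ~-functional (same _ _)      (same _ _)        = refl
  ~-functional (same K≤l _)    (shift l<K _ _)   = contradiction K≤l (<⇒≱ l<K)
  ~-functional (shift l<K _ _) (same K≤l _)      = contradiction K≤l (<⇒≱ l<K)
  ~-functional (shift _ p q)   (shift _ p′ q′) with refl ← ~-functional p p′ =
    cong (λ l → node l _) (~-injective q q′)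

  ~-injective (same _ _)    (same _ _)    = refl
  ~-injective (same _ e)    (shift _ _ q) = case trans (sym e) (~-longOdd q) of λ ()
  ~-injective (shift _ _ q) (same _ e)    = case trans (sym e) (~-longOdd q) of λ ()
  ~-injective (shift {l₂ = l₂} _ p q) (shift {l₂ = l₂′} _ p′ q′)
    with swap l₂ in e | swap l₂′ in e′ | ~-functional q q′
  ... | _ | _ | refl with refl ← swap-injective (trans e (sym e′)) =
    cong (node _) (~-injective p p′)

  -- The tree to which `shift` applies the converse is not a subtree of the given one, only a
  -- smaller tree; hence the bound `k` and the simultaneous induction.
  ~-total : ∀ k t → size t ≤ k → size t ≤ K + K → longOdd t ≡ true → ∃ λ u → t ~ u
  ~-surjective : ∀ k u → size u ≤ k → size u ≤ K + K → firstLong u ≡ true → ∃ λ t → t ~ u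

  ~-total (suc k) (node l r) (s≤s lr≤k) lr<2K odd with <-≤-connex (size l) K
  ... | inj₂ K≤l = node l r , same K≤l (not-true⇒false (trans (sym (longOdd-long l r K≤l)) odd))
  ... | inj₁ l<K
    with ~-total k r (≤-trans (m≤n+m _ _) lr≤k) (≤-trans (m≤n+m _ _) (<⇒≤ lr<2K))
                 (trans (sym (longOdd-short l r l<K)) odd)
  ... | leaf , p = case ~-firstLong p of λ ()
  ... | node l₂ r₂ , p =
    let l₂l≤lr = begin
          suc (size (swap l₂) + size l) ≡⟨ cong (λ x → suc (x + size l)) (size-swap l₂) ⟩
          suc (size l₂ + size l)        ≤⟨ s≤s (+-monoˡ-≤ (size l) (m≤m+n (size l₂) (size r₂))) ⟩
          suc (size l₂ + size r₂) + size l ≡⟨ +-comm (size (node l₂ r₂)) (size l) ⟩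
          size l + size (node l₂ r₂)    ≡⟨ cong (λ x → size l + x) (~-size p) ⟨
          size l + size r               ∎
        l′ , q = ~-surjective k (node (swap l₂) l) (≤-trans l₂l≤lr lr≤k) (≤-trans l₂l≤lr (<⇒≤ lr<2K))
                   (trans (cong (K ≤ᵇ_) (size-swap l₂)) (~-firstLong p))
    in node l′ r₂ , shift l<K p q
    where open ≤-Reasoning

  ~-surjective (suc k) (node l r) (s≤s lr≤k) lr<2K first with longOdd l in odd
  ... | false = node l r , same (≤ᵇ-true⁻¹ K (size l) first) odd
  ... | true with ~-total k l (≤-trans (m≤m+n _ _) lr≤k) (≤-trans (m≤m+n _ _) (<⇒≤ lr<2K)) odd
  ...   | leaf , p = case ~-firstLong p of λ ()
  ...   | node l₁ r₁ , p =
    let K≤l₁ = ≤ᵇ-true⁻¹ K (size l₁) (~-firstLong p)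
        -- `r₁` becomes the interior of the first edge of the preimage, which `shift` requires to be
        -- short. Next to the long `l₁`, the bound `K + K` leaves it no more room.
        r₁<K = +-cancelˡ-≤ K (suc (size r₁)) K (begin
          K + suc (size r₁)             ≤⟨ +-monoˡ-≤ (suc (size r₁)) K≤l₁ ⟩
          size l₁ + suc (size r₁)       ≡⟨ +-suc (size l₁) (size r₁) ⟩
          size (node l₁ r₁)             ≡⟨ ~-size p ⟨
          size l                        ≤⟨ m≤m+n _ _ ⟩
          size l + size r               ≤⟨ <⇒≤ lr<2K ⟩
          K + K                         ∎)
        l₁r≤lr = begin
          suc (size (swap l₁) + size r) ≡⟨ cong (λ x → suc (x + size r)) (size-swap l₁) ⟩
          suc (size l₁ + size r)        ≤⟨ +-monoˡ-≤ (size r) (s≤s (m≤m+n (size l₁) (size r₁))) ⟩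
          size (node l₁ r₁) + size r    ≡⟨ cong (_+ size r) (~-size p) ⟨
          size l + size r               ∎
        r′ , q = ~-surjective k (node (swap l₁) r) (≤-trans l₁r≤lr lr≤k) (≤-trans l₁r≤lr (<⇒≤ lr<2K))
                   (trans (cong (K ≤ᵇ_) (size-swap l₁)) (~-firstLong p))
    in node r₁ r′ , shift r₁<K q (subst (λ x → l ~ node x r₁) (sym (swap-involutive l₁)) p)
    where open ≤-Reasoning

  TreeClass : ℕ → ℕ → Tree → Set
  TreeClass n c t = size t ≡ n × oddEdges false t ≡ c

  TreeClass-irrelevant : ∀ n c t → Irrelevant (TreeClass n c t)
  TreeClass-irrelevant n c t = ×-irrelevant ≡-irrelevant ≡-irrelevant

  longOdd-↔-firstLong : ∀ n c → n ≤ K + K →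
    Σ Tree (λ t → TreeClass n c t × longOdd t ≡ true) ↔
    Σ Tree (λ t → TreeClass n c t × firstLong t ≡ true)
  longOdd-↔-firstLong n c n≤2K = relation-↔ _~_
    (λ t → ×-irrelevant (TreeClass-irrelevant n c t) ≡-irrelevant)
    (λ t → ×-irrelevant (TreeClass-irrelevant n c t) ≡-irrelevant)
    (λ { t ((refl , e) , odd) → let u , p = ~-total _ t ≤-refl n≤2K odd in
         u , ((sym (~-size p) , trans (sym (~-oddEdges false p)) e) , ~-firstLong p) , p })
    (λ { u ((refl , e) , first) → let t , p = ~-surjective _ u ≤-refl n≤2K first in
         t , ((~-size p , trans (~-oddEdges false p) e) , ~-longOdd p) , p })
    (λ _ _ _ _ _ → ~-functional)
    (λ _ _ _ _ _ → ~-injective)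

  -- Exchanging the two subtrees of the root.

  leftLeaf : Tree → Bool
  leftLeaf leaf       = true
  leftLeaf (node l r) = isLeaf l

  rightLeaf : Tree → Bool
  rightLeaf leaf       = true
  rightLeaf (node l r) = isLeaf r

  exchange : Tree → Tree
  exchange leaf       = leaf
  exchange (node l r) = node (swap r) (swap l)

  exchange-involutive : ∀ t → exchange (exchange t) ≡ t
  exchange-involutive leaf       = refl
  exchange-involutive (node l r) = cong₂ node (swap-involutive l) (swap-involutive r)

  size-exchange : ∀ t → size (exchange t) ≡ size t
  size-exchange leaf       = refl
  size-exchange (node l r) = cong suc
    (trans (cong₂ _+_ (size-swap r) (size-swap l)) (+-comm (size r) (size l)))

  -- The left subtree moves from an odd start to an even one and loses one odd edge; the right
  -- subtree moves the other way and gains one.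
  oddEdges-exchange : ∀ l r → isLeaf l ≡ false → isLeaf r ≡ false →
    oddEdges false (exchange (node l r)) ≡ oddEdges false (node l r)
  oddEdges-exchange l r l-nonLeaf r-nonLeaf = begin
    oddEdges true (swap r) + oddEdges false (swap l)
      ≡⟨ cong (_+ oddEdges false (swap l)) (oddEdges-swap′ r r-nonLeaf) ⟩
    suc (oddEdges false r + oddEdges false (swap l))
      ≡⟨ cong suc (+-comm (oddEdges false r) (oddEdges false (swap l))) ⟩
    suc (oddEdges false (swap l)) + oddEdges false r
      ≡⟨ cong (_+ oddEdges false r) (oddEdges-swap l l-nonLeaf) ⟨
    oddEdges true l + oddEdges false r ∎
    where open ≡-Reasoning

  -- The sum of `a` and `b` is `2 * K - 1`, so they cannot both stay below `K`; by
  -- `complement-short` they cannot both reach it either.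
  complement-long : ∀ {a b} → suc (a + b) ≡ K + K → a < K → K ≤ b
  complement-long {a} {b} e a<K = +-cancelˡ-≤ (suc a) K b (begin
    suc a + K   ≤⟨ +-monoˡ-≤ K a<K ⟩
    K + K       ≡⟨ e ⟨
    suc (a + b) ∎)
    where open ≤-Reasoning

  complement-short : ∀ {a b} → suc (a + b) ≡ K + K → K ≤ a → b < K
  complement-short {a} {b} e K≤a = +-cancelˡ-≤ K (suc b) K (begin
    K + suc b   ≤⟨ +-monoˡ-≤ (suc b) K≤a ⟩
    a + suc b   ≡⟨ +-suc a b ⟩
    suc (a + b) ≡⟨ e ⟩
    K + K       ∎)
    where open ≤-Reasoning

  module _ (m c : ℕ) (m+1≡2K : suc m ≡ K + K) where

    ShortFirst LongFirst ShiftedClass : Tree → Set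
    ShortFirst t = (TreeClass (suc m) c t × firstLong t ≡ false) × leftLeaf t ≡ false
    LongFirst t = (TreeClass (suc m) c t × firstLong t ≡ true) × rightLeaf t ≡ false
    ShiftedClass t = size t ≡ m × suc (oddEdges false t) ≡ c

    class∧-irrelevant : ∀ n {b d : Bool} {a a′ : Tree → Bool} t →
      Irrelevant ((TreeClass n c t × a t ≡ b) × a′ t ≡ d)
    class∧-irrelevant n t =
      ×-irrelevant (×-irrelevant (TreeClass-irrelevant n c t) ≡-irrelevant) ≡-irrelevant

    exchange-↔ : Σ Tree ShortFirst ↔ Σ Tree LongFirst
    exchange-↔ = restrict-↔ (class∧-irrelevant (suc m)) (class∧-irrelevant (suc m))
      exchange exchange to from (λ t _ → exchange-involutive t) (λ t _ → exchange-involutive t)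
      where
      to : ∀ t → ShortFirst t → LongFirst (exchange t)
      to (node l r) (((s , o) , short) , l-nonLeaf) =
        ((trans (size-exchange (node l r)) s ,
          trans (oddEdges-exchange l r l-nonLeaf (nonLeaf r (≤-trans 0<K K≤r))) o) ,
         trans (cong (K ≤ᵇ_) (size-swap r)) (≤ᵇ-true K≤r)) ,
        trans (isLeaf-swap l) l-nonLeaf
        where
        K≤r : K ≤ size r
        K≤r = complement-long (trans s m+1≡2K) (≤ᵇ-false⁻¹ K (size l) short)

      from : ∀ t → LongFirst t → ShortFirst (exchange t)
      from (node l r) (((s , o) , long) , r-nonLeaf) =
        ((trans (size-exchange (node l r)) s ,
          trans (oddEdges-exchange l r (nonLeaf l (≤-trans 0<K K≤l)) r-nonLeaf) o) ,
         trans (cong (K ≤ᵇ_) (size-swap r)) (≤ᵇ-false r<K)) ,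
        trans (isLeaf-swap r) r-nonLeaf
        where
        K≤l : K ≤ size l
        K≤l = ≤ᵇ-true⁻¹ K (size l) long
        r<K : size r < K
        r<K = complement-short (trans s m+1≡2K) K≤l

    -- A first edge `()` is not odd and takes up two positions, so deleting it leaves the parity of
    -- all other edges unchanged.
    leftLeaf-↔ : Σ Tree (λ t → (TreeClass (suc m) c t × firstLong t ≡ false) × leftLeaf t ≡ true) ↔
                 Σ Tree (TreeClass m c)
    leftLeaf-↔ = restrict-↔ (class∧-irrelevant (suc m)) (TreeClass-irrelevant m c)
      right (node leaf) to from (λ _ _ → refl) right-inverse
      where
      right : Tree → Tree
      right leaf       = leaf
      right (node l r) = r

      to : ∀ t → (TreeClass (suc m) c t × firstLong t ≡ false) × leftLeaf t ≡ true → TreeClass m c (right t)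
      to (node leaf r) (((s , o) , _) , _) = suc-injective s , o

      from : ∀ t → TreeClass m c t →
        (TreeClass (suc m) c (node leaf t) × (K ≤ᵇ 0) ≡ false) × true ≡ true
      from t (s , o) = ((cong suc s , o) , ≤ᵇ-false 0<K) , refl

      right-inverse : ∀ t → (TreeClass (suc m) c t × firstLong t ≡ false) × leftLeaf t ≡ true →
        node leaf (right t) ≡ t
      right-inverse (node leaf r) _ = refl

    -- The root edge encloses all `m` other edges, and `K ≤ m`, so it is long in any case. Removing
    -- it moves the interior from an odd start to an even one, and the accompanying swap costs one
    -- odd edge: this is the source of c - 1.
    rightLeaf-↔ : Σ Tree (λ t → (TreeClass (suc m) c t × firstLong t ≡ true) × rightLeaf t ≡ true) ↔
                  Σ Tree ShiftedClass
    rightLeaf-↔ = restrict-↔ (class∧-irrelevant (suc m)) (λ _ → ×-irrelevant ≡-irrelevant ≡-irrelevant)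
      left (λ t → node (swap t) leaf) to from (λ t _ → swap-involutive t) left-inverse
      where
      open ≡-Reasoning

      left : Tree → Tree
      left leaf       = leaf
      left (node l r) = swap l

      K≤m : K ≤ m
      K≤m = m<1+n⇒m≤n (≤-trans (m<m+n K 0<K) (≤-reflexive (sym m+1≡2K)))

      to : ∀ t → (TreeClass (suc m) c t × firstLong t ≡ true) × rightLeaf t ≡ true → ShiftedClass (left t)
      to (node l leaf) (((s , o) , long) , _) =
        (begin
          size (swap l)     ≡⟨ size-swap l ⟩
          size l            ≡⟨ +-identityʳ (size l) ⟨
          size l + 0        ≡⟨ suc-injective s ⟩
          m                 ∎) ,
        (begin
          suc (oddEdges false (swap l)) ≡⟨ oddEdges-swap l (nonLeaf l (≤-trans 0<K (≤ᵇ-true⁻¹ K (size l) long))) ⟨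
          oddEdges true l               ≡⟨ +-identityʳ _ ⟨
          oddEdges true l + 0           ≡⟨ o ⟩
          c                             ∎)

      from : ∀ t → ShiftedClass t →
        (TreeClass (suc m) c (node (swap t) leaf) × (K ≤ᵇ size (swap t)) ≡ true) × true ≡ true
      from t (s , o) =
        ((cong suc (trans (+-identityʳ _) (trans (size-swap t) s)) ,
          trans (+-identityʳ _) (trans (oddEdges-swap′ t (nonLeaf t (≤-trans 0<K K≤t))) o)) ,
         ≤ᵇ-true (≤-trans K≤t (≤-reflexive (sym (size-swap t))))) , refl
        where
        K≤t : K ≤ size t
        K≤t = ≤-trans K≤m (≤-reflexive (sym s))

      left-inverse : ∀ t → (TreeClass (suc m) c t × firstLong t ≡ true) × rightLeaf t ≡ true →
        node (swap (left t)) leaf ≡ t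
      left-inverse (node l leaf) _ = cong (λ l → node l leaf) (swap-involutive l)

    -- By the second exchange there is a common `q` such that `t₃ + q` trees have a long first edge
    -- and `t₂ + q` a short one. The trees with an odd number of long edges are as many as the
    -- former, so those with an even number are as many as the latter: `f = t₂ + q`.
    longEven-HasSize : ∀ {t₁ t₂ t₃} →
      Σ Tree (TreeClass (suc m) c) HasSize t₁ →
      Σ Tree (TreeClass m c) HasSize t₂ →
      Σ Tree ShiftedClass HasSize t₃ →
      ∃ λ f → (Σ Tree (λ t → TreeClass (suc m) c t × longOdd t ≡ false) HasSize f) ×
              f + f + t₃ ≡ t₁ + t₂
    longEven-HasSize {t₁} {t₂} {t₃} size₁ size₂ size₃ =
      let o , f , size-o , size-f , o+f≡t₁ = split-HasSize irr size₁ longOdd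
          x , y , size-x , size-y , x+y≡t₁ = split-HasSize irr size₁ firstLong
          y₁ , q , size-y₁ , size-q , y₁+q≡y = split-HasSize irr′ size-y leftLeaf
          x₁ , q′ , size-x₁ , size-q′ , x₁+q′≡x = split-HasSize irr′ size-x rightLeaf
          o≡x  = HasSize-unique (↔-trans size-o (longOdd-↔-firstLong (suc m) c (≤-reflexive m+1≡2K))) size-x
          y₁≡t₂ = HasSize-unique (↔-trans size-y₁ leftLeaf-↔) size₂
          x₁≡t₃ = HasSize-unique (↔-trans size-x₁ rightLeaf-↔) size₃
          q≡q′ = HasSize-unique (↔-trans size-q exchange-↔) size-q′
      in f , size-f , arith o f x y y₁ q x₁ q′ o+f≡t₁ x+y≡t₁ y₁+q≡y x₁+q′≡x o≡x y₁≡t₂ x₁≡t₃ q≡q′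
      where
      irr = TreeClass-irrelevant (suc m) c
      irr′ : ∀ {b : Bool} {a : Tree → Bool} t → Irrelevant (TreeClass (suc m) c t × a t ≡ b)
      irr′ t = ×-irrelevant (irr t) ≡-irrelevant

      solve-for-f : ∀ f t₂ t₃ q → f ≡ t₂ + q → f + f + t₃ ≡ ((t₃ + q) + f) + t₂
      solve-for-f _ t₂ t₃ q refl = lemma t₂ t₃ q
        where
        lemma : ∀ t₂ t₃ q → (t₂ + q) + (t₂ + q) + t₃ ≡ ((t₃ + q) + (t₂ + q)) + t₂
        lemma = ℕ-Solver.solve-∀

      arith : ∀ o f x y y₁ q x₁ q′ → o + f ≡ t₁ → x + y ≡ t₁ → y₁ + q ≡ y → x₁ + q′ ≡ x →
        o ≡ x → y₁ ≡ t₂ → x₁ ≡ t₃ → q ≡ q′ → f + f + t₃ ≡ t₁ + t₂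
      arith o f _ _ _ q _ _ refl e refl refl refl refl refl refl =
        solve-for-f f t₂ t₃ q (sym (+-cancelˡ-≡ (t₃ + q) _ _ e))

-- Narayana numbers

-- Forests allow a word to be read one bracket at a time: an opening bracket replaces the pending
-- tree `node l r` by the two pending trees `l` and `r`, a closing one discards a pending leaf.
forestSize : ∀ {k} → Vec Tree k → ℕ
forestSize []       = 0
forestSize (t ∷ ts) = size t + forestSize ts

-- Consecutive trees are separated by a closing bracket, hence the alternation.
forestOdd : ∀ {k} → Bool → Vec Tree k → ℕ
forestOdd p []       = 0
forestOdd p (t ∷ ts) = oddEdges p t + forestOdd (not p) ts

ForestClass : Bool → (n c : ℕ) → ∀ {k} → Vec Tree k → Set
ForestClass p n c f = forestSize f ≡ n × forestOdd p f ≡ c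

ForestClass-irrelevant : ∀ p n c {k} (f : Vec Tree k) → Irrelevant (ForestClass p n c f)
ForestClass-irrelevant p n c f = ×-irrelevant ≡-irrelevant ≡-irrelevant

-- The two summands correspond to reading a closing or an opening bracket.
forests : (k n : ℕ) → Bool → ℕ → ℕ
forests zero    zero    p     zero    = 1
forests zero    zero    p     (suc c) = 0
forests zero    (suc n) p     c       = 0
forests (suc k) zero    p     c       = forests k zero (not p) c
forests (suc k) (suc n) false c       = forests k (suc n) true c + forests (2 + k) n true c
forests (suc k) (suc n) true  zero    = forests k (suc n) false zero
forests (suc k) (suc n) true  (suc c) = forests k (suc n) false (suc c) + forests (2 + k) n false c

headLeaf : ∀ {k} → Vec Tree (suc k) → Bool
headLeaf (t ∷ _) = isLeaf t

closing-↔ : ∀ p n c k →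
  Σ (Vec Tree (suc k)) (λ f → ForestClass p n c f × headLeaf f ≡ true) ↔
  Σ (Vec Tree k) (ForestClass (not p) n c)
closing-↔ p n c k = restrict-↔
  (λ f → ×-irrelevant (ForestClass-irrelevant p n c f) ≡-irrelevant) (ForestClass-irrelevant (not p) n c)
  (λ { (t ∷ ts) → ts }) (leaf ∷_)
  (λ { (leaf ∷ ts) (class , _) → class ; (node _ _ ∷ _) (_ , ()) }) (λ ts class → class , refl)
  (λ _ _ → refl) (λ { (leaf ∷ ts) _ → refl ; (node _ _ ∷ _) (_ , ()) })

opening-↔ : ∀ p n c k →
  Σ (Vec Tree (suc k)) (λ f → ForestClass p n c f × headLeaf f ≡ false) ↔
  Σ (Vec Tree (2 + k)) (λ f → suc (forestSize f) ≡ n × bit p + forestOdd (not p) f ≡ c)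
opening-↔ p n c k = restrict-↔
  (λ f → ×-irrelevant (ForestClass-irrelevant p n c f) ≡-irrelevant)
  (λ f → ×-irrelevant ≡-irrelevant ≡-irrelevant)
  open′ close to from (λ { (l ∷ r ∷ ts) _ → refl }) (λ { (leaf ∷ _) (_ , ()) ; (node l r ∷ ts) _ → refl })
  where
  open′ : Vec Tree (suc k) → Vec Tree (2 + k)
  open′ (leaf     ∷ ts) = leaf ∷ leaf ∷ ts
  open′ (node l r ∷ ts) = l ∷ r ∷ ts

  close : Vec Tree (2 + k) → Vec Tree (suc k)
  close (l ∷ r ∷ ts) = node l r ∷ ts

  size-eq : ∀ l r (ts : Vec Tree k) → forestSize (l ∷ r ∷ ts) ≡ size l + size r + forestSize ts
  size-eq l r ts = sym (+-assoc (size l) (size r) (forestSize ts))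

  odd-eq : ∀ l r (ts : Vec Tree k) →
    bit p + forestOdd (not p) (l ∷ r ∷ ts) ≡ forestOdd p (node l r ∷ ts)
  odd-eq l r ts rewrite not-involutive p =
    trans (cong (λ x → bit p + x) (sym (+-assoc (oddEdges (not p) l) (oddEdges p r) _)))
          (sym (+-assoc (bit p) (oddEdges (not p) l + oddEdges p r) _))

  to : ∀ f → ForestClass p n c f × headLeaf f ≡ false →
    suc (forestSize (open′ f)) ≡ n × bit p + forestOdd (not p) (open′ f) ≡ c
  to (node l r ∷ ts) ((s , o) , _) =
    trans (cong suc (size-eq l r ts)) s , trans (odd-eq l r ts) o

  from : ∀ f → suc (forestSize f) ≡ n × bit p + forestOdd (not p) f ≡ c →
    ForestClass p n c (close f) × headLeaf (close f) ≡ false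
  from (l ∷ r ∷ ts) (s , o) =
    (trans (cong suc (sym (size-eq l r ts))) s , trans (sym (odd-eq l r ts)) o) , refl

head-HasSize : ∀ k n p c {i j} → Σ (Vec Tree k) (ForestClass (not p) n c) HasSize i →
  Σ (Vec Tree (2 + k)) (λ f → suc (forestSize f) ≡ n × bit p + forestOdd (not p) f ≡ c) HasSize j →
  Σ (Vec Tree (suc k)) (ForestClass p n c) HasSize i + j
head-HasSize k n p c size-i size-j = ↔-trans
  (HasSize-⊎ (↔-trans size-i (↔-sym (closing-↔ p n c k))) (↔-trans size-j (↔-sym (opening-↔ p n c k))))
  (↔-sym (filter-↔ (ForestClass-irrelevant p n c) headLeaf))

forests-HasSize : ∀ k n p c → Σ (Vec Tree k) (ForestClass p n c) HasSize forests k n p c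
forests-HasSize zero zero p zero = singleton-HasSize ([] , refl , refl)
  λ { ([] , s , o) → Σ-≡ (ForestClass-irrelevant p 0 0) refl }
forests-HasSize zero zero    p (suc c) = empty-HasSize λ { ([] , _ , ()) }
forests-HasSize zero (suc n) p c       = empty-HasSize λ { ([] , () , _) }
forests-HasSize (suc k) zero p c =
  subst (Σ (Vec Tree (suc k)) (ForestClass p zero c) HasSize_) (+-identityʳ _)
    (head-HasSize k zero p c (forests-HasSize k zero (not p) c) (empty-HasSize λ { (_ , () , _) }))
forests-HasSize (suc k) (suc n) false c =
  head-HasSize k (suc n) false c (forests-HasSize k (suc n) true c)
    (↔-trans (forests-HasSize (2 + k) n true c)
      (same-↔ (ForestClass-irrelevant true n c) (λ _ → ×-irrelevant ≡-irrelevant ≡-irrelevant)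
        (λ _ (s , o) → cong suc s , o) (λ _ (s , o) → suc-injective s , o)))
forests-HasSize (suc k) (suc n) true zero =
  subst (Σ (Vec Tree (suc k)) (ForestClass true (suc n) zero) HasSize_) (+-identityʳ _)
    (head-HasSize k (suc n) true zero (forests-HasSize k (suc n) false zero) (empty-HasSize λ { (_ , _ , ()) }))
forests-HasSize (suc k) (suc n) true (suc c) =
  head-HasSize k (suc n) true (suc c) (forests-HasSize k (suc n) false (suc c))
    (↔-trans (forests-HasSize (2 + k) n false c)
      (same-↔ (ForestClass-irrelevant false n c) (λ _ → ×-irrelevant ≡-irrelevant ≡-irrelevant)
        (λ _ (s , o) → cong suc s , cong suc o) (λ _ (s , o) → suc-injective s , suc-injective o)))

-- The first bracket of a nonempty tree opens an edge at an even position and leaves two pending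
-- trees at an odd one. `forests 1 (suc n) false c` reduces to the stated number because its other
-- summand, an immediate closing bracket, is 0.
trees-HasSize : ∀ n c →
  Σ Tree (λ t → size t ≡ suc n × oddEdges false t ≡ c) HasSize forests 2 n true c
trees-HasSize n c = ↔-trans (forests-HasSize 1 (suc n) false c)
  (restrict-↔ (ForestClass-irrelevant false (suc n) c) (λ _ → ×-irrelevant ≡-irrelevant ≡-irrelevant)
    (λ { (t ∷ []) → t }) (_∷ [])
    (λ { (t ∷ []) (s , o) → trans (sym (+-identityʳ _)) s , trans (sym (+-identityʳ _)) o })
    (λ t (s , o) → trans (+-identityʳ _) s , trans (+-identityʳ _) o)
    (λ _ _ → refl) (λ { (t ∷ []) _ → refl }))

forests-empty : ∀ k p → forests k 0 p 0 ≡ 1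
forests-empty zero    p = refl
forests-empty (suc k) p = forests-empty k (not p)

forests-excess : ∀ k n p c → n < c → forests k n p c ≡ 0
forests-excess zero    zero    p     (suc c) n<c = refl
forests-excess zero    (suc n) p     c       n<c = refl
forests-excess (suc k) zero    p     c       n<c = forests-excess k zero (not p) c n<c
forests-excess (suc k) (suc n) false c       n<c =
  cong₂ _+_ (forests-excess k (suc n) true c n<c) (forests-excess (2 + k) n true c (<⇒≤ n<c))
forests-excess (suc k) (suc n) true  (suc c) n<c =
  cong₂ _+_ (forests-excess k (suc n) false (suc c) n<c) (forests-excess (2 + k) n false c (≤-pred n<c))

-- The shift f ↦ (k ↦ f (k - 1)) of sequences extended by 0 to negative indices.
↓ : (ℕ → ℤ) → ℕ → ℤ
↓ f zero    = + 0
↓ f (suc k) = f k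

row : ℕ → ℕ → ℤ
row i k = + (i C k)

nC0≡1 : ∀ n → n C 0 ≡ 1
nC0≡1 n = trans (nCk≡nC[n∸k] {n = n} z≤n) (nCn≡1 n)

row-suc : ∀ i k → row (suc i) k ≡ row i k ℤ.+ ↓ (row i) k
row-suc i zero    = trans (cong +_ (trans (nC0≡1 (suc i)) (sym (nC0≡1 i)))) (sym (ℤₚ.+-identityʳ _))
row-suc i (suc k) = trans (cong +_ (trans (sym (nCk+nC[k+1]≡[n+1]C[k+1] i k)) (+-comm (i C k) _)))
                          (ℤₚ.pos-+ (i C suc k) (i C k))

↓row-suc : ∀ i k → ↓ (row (suc i)) k ≡ ↓ (row i) k ℤ.+ ↓ (↓ (row i)) k
↓row-suc i zero    = refl
↓row-suc i (suc k) = row-suc i k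

minor : (f g : ℕ → ℤ) → ℕ → ℕ → ℤ
minor f g a b = f a ℤ.* g b ℤ.- ↓ f a ℤ.* ↓ g b

-- Reading two brackets at a time, the first product counts all choices of `a` openings at even and
-- `b` openings at odd positions in `i` steps. The second product, with both indices lowered, counts
-- the words reflected at the forbidden height.
D : ℕ → ℕ → ℕ → ℤ
D i = minor (row i) (row i)

-- Pascal's rule in both rows. The four minors stand, in this order, for the bracket pairs
-- closing-closing, closing-opening, opening-closing and opening-opening, the first bracket being at
-- an odd position.
D-suc : ∀ i a b → D (suc i) a b ≡
  (D i a b ℤ.+ minor (↓ (row i)) (row i) a b) ℤ.+ (minor (row i) (↓ (row i)) a b ℤ.+ minor (↓ (row i)) (↓ (row i)) a b)
D-suc i a b = trans
  (cong₂ ℤ._-_ (cong₂ ℤ._*_ (row-suc i a) (row-suc i b)) (cong₂ ℤ._*_ (↓row-suc i a) (↓row-suc i b)))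
  (lemma (row i a) (↓ (row i) a) (↓ (↓ (row i)) a) (row i b) (↓ (row i) b) (↓ (↓ (row i)) b))
  where
  lemma : ∀ a₀ a₁ a₂ b₀ b₁ b₂ →
    (a₀ ℤ.+ a₁) ℤ.* (b₀ ℤ.+ b₁) ℤ.- (a₁ ℤ.+ a₂) ℤ.* (b₁ ℤ.+ b₂) ≡
    ((a₀ ℤ.* b₀ ℤ.- a₁ ℤ.* b₁) ℤ.+ (a₁ ℤ.* b₀ ℤ.- a₂ ℤ.* b₁)) ℤ.+
    ((a₀ ℤ.* b₁ ℤ.- a₁ ℤ.* b₂) ℤ.+ (a₁ ℤ.* b₁ ℤ.- a₂ ℤ.* b₂))
  lemma = ℤ-Solver.solve-∀

C-sym : ∀ a b → (a + b) C a ≡ (a + b) C b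
C-sym a b = trans (nCk≡nC[n∸k] (m≤m+n a b)) (cong ((a + b) C_) (m+n∸m≡n a b))

-- Symmetry of the binomial coefficients: for `a + b = i + 1`, C(i,a) = C(i,b-1) and C(i,b) =
-- C(i,a-1), so the two products agree.
D-boundary : ∀ i a b → a + b ≡ suc i → D i a b ≡ + 0
D-boundary i zero .(suc i) refl =
  cong₂ ℤ._-_ (trans (cong (λ x → row i 0 ℤ.* + x) (k>n⇒nCk≡0 (n<1+n i))) (ℤₚ.*-zeroʳ (row i 0))) (refl {x = + 0})
D-boundary i (suc a) zero e with refl ← trans (sym (+-identityʳ a)) (suc-injective e) =
  cong₂ ℤ._-_ (cong (λ x → + x ℤ.* row i 0) (k>n⇒nCk≡0 (n<1+n i))) (ℤₚ.*-zeroʳ (row i i))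
D-boundary i (suc a) (suc b) e with refl ← suc-injective e = begin
  row i (suc a) ℤ.* row i (suc b) ℤ.- row i a ℤ.* row i b
    ≡⟨ cong₂ (λ x y → x ℤ.* y ℤ.- row i a ℤ.* row i b) (cong +_ lemma₁) (cong +_ (sym (C-sym a (suc b)))) ⟩
  row i b ℤ.* row i a ℤ.- row i a ℤ.* row i b
    ≡⟨ cong (ℤ._- row i a ℤ.* row i b) (ℤₚ.*-comm (row i b) (row i a)) ⟩
  row i a ℤ.* row i b ℤ.- row i a ℤ.* row i b
    ≡⟨ ℤₚ.+-inverseʳ (row i a ℤ.* row i b) ⟩
  + 0 ∎
  where
  open ≡-Reasoning
  lemma₁ : (a + suc b) C suc a ≡ (a + suc b) C b
  lemma₁ rewrite +-suc a b = C-sym (suc a) b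

double : ℕ → ℕ
double zero    = zero
double (suc d) = suc (suc (double d))

minor-zeroʳ : ∀ f g a → minor f (↓ g) a 0 ≡ + 0
minor-zeroʳ f g a = cong₂ ℤ._-_ (ℤₚ.*-zeroʳ (f a)) (ℤₚ.*-zeroʳ (↓ f a))

-- The reflection principle: both sides satisfy the same recurrence (two brackets
-- at a time) and D vanishes at the forbidden height.
forests-formula : ∀ i d a b n → n ≡ a + b → i ≡ n + d →
  + forests (double (suc d)) n true b ≡ D i a b
forests-formula i d zero zero zero _ _ =
  trans (cong +_ (forests-empty (double (suc d)) true))
        (sym (cong (λ x → + x ℤ.* + x ℤ.- + 0) (nC0≡1 i)))
forests-formula (suc i) d (suc a) zero (suc m) n≡a+b i≡n+d = begin
  + (forests (double d) (suc m) true 0 + forests (double (suc d)) m true 0)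
    ≡⟨ ℤₚ.pos-+ (forests (double d) (suc m) true 0) _ ⟩
  + forests (double d) (suc m) true 0 ℤ.+ + forests (double (suc d)) m true 0
    ≡⟨ cong₂ ℤ._+_ (closing d (suc-injective i≡n+d))
         (forests-formula i d a zero m (suc-injective n≡a+b) (suc-injective i≡n+d)) ⟩
  D i (suc a) 0 ℤ.+ D i a 0
    ≡⟨ ℤₚ.+-identityʳ _ ⟨
  (D i (suc a) 0 ℤ.+ D i a 0) ℤ.+ (+ 0 ℤ.+ + 0)
    ≡⟨ cong₂ (λ x y → (D i (suc a) 0 ℤ.+ D i a 0) ℤ.+ (x ℤ.+ y))
         (minor-zeroʳ (row i) (row i) (suc a)) (minor-zeroʳ (↓ (row i)) (row i) (suc a)) ⟨
  _ ≡⟨ D-suc i (suc a) 0 ⟨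
  D (suc i) (suc a) 0 ∎
  where
  open ≡-Reasoning
  closing : ∀ d → i ≡ m + d → + forests (double d) (suc m) true 0 ≡ D i (suc a) 0
  -- No pending tree is left although edges remain to be drawn, so the count is 0; this is the
  -- forbidden height.
  closing zero    e = sym (D-boundary i (suc a) 0
    (trans (sym n≡a+b) (cong suc (trans (sym (+-identityʳ m)) (sym e)))))
  closing (suc d) e = forests-formula i d (suc a) 0 (suc m) n≡a+b (trans e (+-suc m d))
forests-formula (suc i) d a (suc b) (suc m) n≡a+b i≡n+d = begin
  + (forests (double d) (suc m) true (suc b) + forests (double (suc d)) m true (suc b)
      + forests (suc (double (suc d))) m false b)
    ≡⟨ ℤₚ.pos-+ (forests (double d) (suc m) true (suc b) + forests (double (suc d)) m true (suc b)) _ ⟩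
  + (forests (double d) (suc m) true (suc b) + forests (double (suc d)) m true (suc b))
      ℤ.+ + forests (suc (double (suc d))) m false b
    ≡⟨ cong (ℤ._+ + forests (suc (double (suc d))) m false b)
         (ℤₚ.pos-+ (forests (double d) (suc m) true (suc b)) _) ⟩
  (+ forests (double d) (suc m) true (suc b) ℤ.+ + forests (double (suc d)) m true (suc b))
      ℤ.+ + forests (suc (double (suc d))) m false b
    ≡⟨ cong₂ ℤ._+_ (cong₂ ℤ._+_ (closing d i≡m+d) (closing-opening a m≡a+b)) (opening m m≡a+b i≡m+d) ⟩
  _ ≡⟨ D-suc i a (suc b) ⟨
  D (suc i) a (suc b) ∎
  where
  open ≡-Reasoning
  m≡a+b : m ≡ a + b
  m≡a+b = suc-injective (trans n≡a+b (+-suc a b))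

  i≡m+d : i ≡ m + d
  i≡m+d = suc-injective i≡n+d

  closing : ∀ d → i ≡ m + d → + forests (double d) (suc m) true (suc b) ≡ D i a (suc b)
  closing zero    e = sym (D-boundary i a (suc b)
    (trans (sym n≡a+b) (cong suc (trans (sym (+-identityʳ m)) (sym e)))))
  closing (suc d) e = forests-formula i d a (suc b) (suc m) n≡a+b (trans e (+-suc m d))

  closing-opening : ∀ a → m ≡ a + b →
    + forests (double (suc d)) m true (suc b) ≡ minor (↓ (row i)) (row i) a (suc b)
  -- With `a = 0` all remaining edges are odd, so an opening at an even position leaves too few
  -- edges.
  closing-opening zero    e = cong +_ (forests-excess (double (suc d)) m true (suc b) (s≤s (≤-reflexive e)))
  closing-opening (suc a) e = forests-formula i d a (suc b) m (trans e (sym (+-suc a b))) i≡m+d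

  opening-opening : ∀ a m → suc m ≡ a + b → i ≡ suc m + d →
    + forests (double (suc (suc d))) m true b ≡ minor (↓ (row i)) (↓ (row i)) a (suc b)
  opening-opening zero    m e e′ = cong +_ (forests-excess (double (suc (suc d))) m true b (≤-reflexive e))
  opening-opening (suc a) m e e′ =
    forests-formula i (suc d) a b m (suc-injective e) (trans e′ (sym (+-suc m d)))

  opening : ∀ m → m ≡ a + b → i ≡ m + d → + forests (suc (double (suc d))) m false b ≡
    minor (row i) (↓ (row i)) a (suc b) ℤ.+ minor (↓ (row i)) (↓ (row i)) a (suc b)
  opening zero e e′ with refl ← m+n≡0⇒m≡0 a (sym e) =
    trans (forests-formula i d 0 b 0 e e′) (sym (ℤₚ.+-identityʳ _))
  opening (suc m) e e′ = trans (ℤₚ.pos-+ (forests (double (suc d)) (suc m) true b) _)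
    (cong₂ ℤ._+_ (forests-formula i d a b (suc m) e e′) (opening-opening a m e e′))

-- This is (k+1) C(n,k+1) = (n-k) C(n,k), written without subtraction so that it also covers k > n.
-- The induction applies Pascal's rule to both terms.
C-absorption : ∀ n k → suc k * (n C suc k) + k * (n C k) ≡ n * (n C k)
C-absorption zero zero = refl
C-absorption zero (suc k)
  rewrite k>n⇒nCk≡0 {0} {suc (suc k)} (s≤s z≤n) | k>n⇒nCk≡0 {0} {suc k} (s≤s z≤n)
  = cong₂ _+_ (*-zeroʳ k) (*-zeroʳ k)
C-absorption (suc n) zero = begin
  1 * (suc n C 1) + 0         ≡⟨ cong (λ x → 1 * x + 0) (nCk+nC[k+1]≡[n+1]C[k+1] n 0) ⟨
  1 * (n C 0 + n C 1) + 0     ≡⟨ lemma (n C 0) (n C 1) ⟩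
  n C 0 + (1 * (n C 1) + 0)   ≡⟨ cong (λ x → n C 0 + x) (C-absorption n 0) ⟩
  suc n * (n C 0)             ≡⟨ cong (suc n *_) (trans (nC0≡1 n) (sym (nC0≡1 (suc n)))) ⟩
  suc n * (suc n C 0)         ∎
  where
  open ≡-Reasoning
  lemma : ∀ a b → 1 * (a + b) + 0 ≡ a + (1 * b + 0)
  lemma = ℕ-Solver.solve-∀
C-absorption (suc n) (suc k)
  rewrite sym (nCk+nC[k+1]≡[n+1]C[k+1] n k) | sym (nCk+nC[k+1]≡[n+1]C[k+1] n (suc k)) = begin
  suc (suc k) * (n C suc k + n C suc (suc k)) + suc k * (n C k + n C suc k)
    ≡⟨ lemma k (n C k) (n C suc k) (n C suc (suc k)) ⟩
  (suc (suc k) * (n C suc (suc k)) + suc k * (n C suc k)) + (suc k * (n C suc k) + k * (n C k))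
    + (n C k + n C suc k)
    ≡⟨ cong₂ (λ x y → x + y + (n C k + n C suc k)) (C-absorption n (suc k)) (C-absorption n k) ⟩
  n * (n C suc k) + n * (n C k) + (n C k + n C suc k)
    ≡⟨ lemma′ n (n C k) (n C suc k) ⟩
  suc n * (n C k + n C suc k) ∎
  where
  open ≡-Reasoning
  lemma : ∀ k a b c → suc (suc k) * (b + c) + suc k * (a + b) ≡
    (suc (suc k) * c + suc k * b) + (suc k * b + k * a) + (a + b)
  lemma = ℕ-Solver.solve-∀
  lemma′ : ∀ n a b → n * b + n * a + (a + b) ≡ suc n * (a + b)
  lemma′ = ℕ-Solver.solve-∀

C-absorption′ : ∀ e k → suc k * ((e + k) C suc k) ≡ e * ((e + k) C k)
C-absorption′ e k = +-cancelʳ-≡ (k * ((e + k) C k)) _ _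
  (trans (C-absorption (e + k) k) (*-distribʳ-+ ((e + k) C k) e k))

D-diagonal : ∀ a b → D (a + b) a b ≡
  row (a + b) b ℤ.* row (a + b) b ℤ.- row (a + b) (suc b) ℤ.* ↓ (row (a + b)) b
D-diagonal a b = cong₂ (λ x y → x ℤ.* row (a + b) b ℤ.- y ℤ.* ↓ (row (a + b)) b) (cong +_ (C-sym a b)) (lemma a)
  where
  lemma : ∀ a → ↓ (row (a + b)) a ≡ row (a + b) (suc b)
  lemma zero    = cong +_ (sym (k>n⇒nCk≡0 (n<1+n b)))
  lemma (suc a) = cong +_ (trans (cong (_C a) (sym (+-suc a b)))
    (trans (C-sym a (suc b)) (cong (_C suc b) (+-suc a b))))

trees-formula : ∀ a b → + forests 2 (a + b) true b ≡
  row (a + b) b ℤ.* row (a + b) b ℤ.- row (a + b) (suc b) ℤ.* ↓ (row (a + b)) b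
trees-formula a b = trans (forests-formula (a + b) 0 a b (a + b) refl (sym (+-identityʳ _))) (D-diagonal a b)

-- From tree counts to the Narayana number.

module _ (e c : ℕ) where
  private
    -- `M` stands for `n - 2`. The row of T(n,c) is one Pascal step above it and the row `n + 1` of
    -- the Narayana number three steps; hence four neighbouring entries `w`, `x`, `y`, `z` of row
    -- `M` suffice.
    M = e + c
    w = ↓ (↓ (row M)) c
    x = ↓ (row M) c
    y = row M c
    z = row M (suc c)
    ê = + e
    ĉ = + c

  absorb-z : (+ 1 ℤ.+ ĉ) ℤ.* z ≡ ê ℤ.* y
  absorb-z = begin
    + suc c ℤ.* z             ≡⟨ ℤₚ.pos-* (suc c) (M C suc c) ⟨
    + (suc c * (M C suc c))   ≡⟨ cong +_ (C-absorption′ e c) ⟩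
    + (e * (M C c))           ≡⟨ ℤₚ.pos-* e (M C c) ⟩
    ê ℤ.* y                   ∎
    where open ≡-Reasoning

  row-3 : row (3 + M) (suc c) ≡ w ℤ.+ + 3 ℤ.* x ℤ.+ + 3 ℤ.* y ℤ.+ z
  row-3 = begin
    row (3 + M) (suc c)                            ≡⟨ row-suc (2 + M) (suc c) ⟩
    row (2 + M) (suc c) ℤ.+ row (2 + M) c
      ≡⟨ cong₂ ℤ._+_ (row-suc (1 + M) (suc c)) (row-suc (1 + M) c) ⟩
    (row (1 + M) (suc c) ℤ.+ row (1 + M) c) ℤ.+ (row (1 + M) c ℤ.+ ↓ (row (1 + M)) c)
      ≡⟨ cong₂ (λ a b → (a ℤ.+ b) ℤ.+ (b ℤ.+ ↓ (row (1 + M)) c)) (row-suc M (suc c)) (row-suc M c) ⟩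
    ((z ℤ.+ y) ℤ.+ (y ℤ.+ x)) ℤ.+ ((y ℤ.+ x) ℤ.+ ↓ (row (1 + M)) c)
      ≡⟨ cong (λ a → ((z ℤ.+ y) ℤ.+ (y ℤ.+ x)) ℤ.+ ((y ℤ.+ x) ℤ.+ a)) (↓row-suc M c) ⟩
    ((z ℤ.+ y) ℤ.+ (y ℤ.+ x)) ℤ.+ ((y ℤ.+ x) ℤ.+ (x ℤ.+ w))
      ≡⟨ lemma w x y z ⟩
    w ℤ.+ + 3 ℤ.* x ℤ.+ + 3 ℤ.* y ℤ.+ z ∎
    where
    open ≡-Reasoning
    lemma : ∀ w x y z → ((z ℤ.+ y) ℤ.+ (y ℤ.+ x)) ℤ.+ ((y ℤ.+ x) ℤ.+ (x ℤ.+ w)) ≡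
      w ℤ.+ + 3 ℤ.* x ℤ.+ + 3 ℤ.* y ℤ.+ z
    lemma = ℤ-Solver.solve-∀

  trees-suc-formula : + forests 2 (suc M) true c ≡ (y ℤ.+ x) ℤ.* (y ℤ.+ x) ℤ.- (z ℤ.+ y) ℤ.* (x ℤ.+ w)
  trees-suc-formula = trans (trees-formula (suc e) c)
    (cong₂ ℤ._-_ (cong₂ ℤ._*_ (row-suc M c) (row-suc M c)) (cong₂ ℤ._*_ (row-suc M (suc c)) (↓row-suc M c)))

absorb-x : ∀ e c → + c ℤ.* row (e + c) c ≡ (+ 1 ℤ.+ + e) ℤ.* ↓ (row (e + c)) c
absorb-x e zero    = sym (ℤₚ.*-zeroʳ (+ 1 ℤ.+ + e))
absorb-x e (suc c) rewrite +-suc e c =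
  trans (sym (ℤₚ.pos-* (suc c) (suc (e + c) C suc c)))
    (trans (cong +_ (C-absorption′ (suc e) c)) (ℤₚ.pos-* (suc e) (suc (e + c) C c)))

absorb-w : ∀ e c → (+ c ℤ.- + 1) ℤ.* ↓ (row (e + c)) c ≡ (+ 2 ℤ.+ + e) ℤ.* ↓ (↓ (row (e + c))) c
absorb-w e zero    = sym (ℤₚ.*-zeroʳ (+ 2 ℤ.+ + e))
absorb-w e (suc c) rewrite +-suc e c = absorb-x (suc e) c

-- The terms `x * x` and `y * w` cancel. The factors on the right are grouped so that `x`, `w` and
-- `z` occur only inside the products that the absorption laws turn into multiples of `y`.
cleared-left : ∀ e c y x w z →
  (+ 1 ℤ.+ c) ℤ.* ((+ 1 ℤ.+ e) ℤ.* (+ 2 ℤ.+ e)) ℤ.* (+ 3 ℤ.+ e ℤ.+ c) ℤ.*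
    (((y ℤ.+ x) ℤ.* (y ℤ.+ x) ℤ.- (z ℤ.+ y) ℤ.* (x ℤ.+ w)) ℤ.+ (y ℤ.* y ℤ.- z ℤ.* x)
      ℤ.- (x ℤ.* x ℤ.- y ℤ.* w)) ≡
  (+ 3 ℤ.+ e ℤ.+ c) ℤ.*
    ((+ 1 ℤ.+ c) ℤ.* (+ 2 ℤ.+ e) ℤ.* ((+ 1 ℤ.+ e) ℤ.* x) ℤ.* y
     ℤ.+ + 2 ℤ.* (+ 1 ℤ.+ c) ℤ.* (+ 1 ℤ.+ e) ℤ.* (+ 2 ℤ.+ e) ℤ.* y ℤ.* y
     ℤ.- ((+ 1 ℤ.+ e) ℤ.* ((+ 2 ℤ.+ e) ℤ.* w)) ℤ.* ((+ 1 ℤ.+ c) ℤ.* z) ℤ.- + 2 ℤ.* (+ 2 ℤ.+ e) ℤ.* ((+ 1 ℤ.+ e) ℤ.* x) ℤ.* ((+ 1 ℤ.+ c) ℤ.* z))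
cleared-left = ℤ-Solver.solve-∀

cleared-right : ∀ e c y x w z →
  + 2 ℤ.* y ℤ.*
    ((+ 1 ℤ.+ c) ℤ.* ((+ 1 ℤ.+ e) ℤ.* ((+ 2 ℤ.+ e) ℤ.* w)) ℤ.+ + 3 ℤ.* (+ 1 ℤ.+ c) ℤ.* (+ 2 ℤ.+ e) ℤ.* ((+ 1 ℤ.+ e) ℤ.* x)
     ℤ.+ + 3 ℤ.* (+ 1 ℤ.+ c) ℤ.* (+ 1 ℤ.+ e) ℤ.* (+ 2 ℤ.+ e) ℤ.* y
     ℤ.+ (+ 1 ℤ.+ e) ℤ.* (+ 2 ℤ.+ e) ℤ.* ((+ 1 ℤ.+ c) ℤ.* z)) ≡
  (+ 2 ℤ.* ((+ 1 ℤ.+ c) ℤ.* ((+ 1 ℤ.+ e) ℤ.* (+ 2 ℤ.+ e)))) ℤ.* ((w ℤ.+ + 3 ℤ.* x ℤ.+ + 3 ℤ.* y ℤ.+ z) ℤ.* y)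
cleared-right = ℤ-Solver.solve-∀

cleared-left≡right : ∀ e c y →
  (+ 3 ℤ.+ e ℤ.+ c) ℤ.*
    ((+ 1 ℤ.+ c) ℤ.* (+ 2 ℤ.+ e) ℤ.* (c ℤ.* y) ℤ.* y
     ℤ.+ + 2 ℤ.* (+ 1 ℤ.+ c) ℤ.* (+ 1 ℤ.+ e) ℤ.* (+ 2 ℤ.+ e) ℤ.* y ℤ.* y
     ℤ.- ((c ℤ.- + 1) ℤ.* (c ℤ.* y)) ℤ.* (e ℤ.* y) ℤ.- + 2 ℤ.* (+ 2 ℤ.+ e) ℤ.* (c ℤ.* y) ℤ.* (e ℤ.* y)) ≡
  + 2 ℤ.* y ℤ.*
    ((+ 1 ℤ.+ c) ℤ.* ((c ℤ.- + 1) ℤ.* (c ℤ.* y)) ℤ.+ + 3 ℤ.* (+ 1 ℤ.+ c) ℤ.* (+ 2 ℤ.+ e) ℤ.* (c ℤ.* y)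
     ℤ.+ + 3 ℤ.* (+ 1 ℤ.+ c) ℤ.* (+ 1 ℤ.+ e) ℤ.* (+ 2 ℤ.+ e) ℤ.* y
     ℤ.+ (+ 1 ℤ.+ e) ℤ.* (+ 2 ℤ.+ e) ℤ.* (e ℤ.* y))
cleared-left≡right = ℤ-Solver.solve-∀

double-scale : ∀ e c f k → (+ 2 ℤ.* ((+ 1 ℤ.+ c) ℤ.* ((+ 1 ℤ.+ e) ℤ.* (+ 2 ℤ.+ e)))) ℤ.* ((+ 3 ℤ.+ e ℤ.+ c) ℤ.* f) ≡
  (+ 1 ℤ.+ c) ℤ.* ((+ 1 ℤ.+ e) ℤ.* (+ 2 ℤ.+ e)) ℤ.* (+ 3 ℤ.+ e ℤ.+ c) ℤ.* ((f ℤ.+ f ℤ.+ k) ℤ.- k)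
double-scale = ℤ-Solver.solve-∀

-- The three absorption laws express w, x and z as rational multiples of y;
-- clearing denominators leaves a polynomial identity in c, e and y.
narayana-identity : ∀ (e c : ℕ) (w x y z f : ℤ) →
  (+ 1 ℤ.+ + c) ℤ.* z ≡ + e ℤ.* y → + c ℤ.* y ≡ (+ 1 ℤ.+ + e) ℤ.* x →
  (+ c ℤ.- + 1) ℤ.* x ≡ (+ 2 ℤ.+ + e) ℤ.* w →
  f ℤ.+ f ℤ.+ (x ℤ.* x ℤ.- y ℤ.* w) ≡
    ((y ℤ.+ x) ℤ.* (y ℤ.+ x) ℤ.- (z ℤ.+ y) ℤ.* (x ℤ.+ w)) ℤ.+ (y ℤ.* y ℤ.- z ℤ.* x) →
  (+ 3 ℤ.+ + e ℤ.+ + c) ℤ.* f ≡ (w ℤ.+ + 3 ℤ.* x ℤ.+ + 3 ℤ.* y ℤ.+ z) ℤ.* y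
narayana-identity e′ c′ w x y z f hz hx hw hf = ℤₚ.*-cancelˡ-≡ (scale) _ _ (begin
  scale ℤ.* ((+ 3 ℤ.+ e ℤ.+ c) ℤ.* f)
    ≡⟨ double-scale e c f k ⟩
  P ℤ.* ((f ℤ.+ f ℤ.+ k) ℤ.- k)
    ≡⟨ cong (λ h → P ℤ.* (h ℤ.- k)) hf ⟩
  P ℤ.* (((y ℤ.+ x) ℤ.* (y ℤ.+ x) ℤ.- (z ℤ.+ y) ℤ.* (x ℤ.+ w)) ℤ.+ (y ℤ.* y ℤ.- z ℤ.* x) ℤ.- k)
    ≡⟨ cleared-left e c y x w z ⟩
  left X W Z
    ≡⟨ cong (λ X → left X W Z) hx ⟨
  left X′ W Z
    ≡⟨ cong₂ (left X′) hW hz ⟩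
  left X′ W′ (e ℤ.* y)
    ≡⟨ cleared-left≡right e c y ⟩
  right X′ W′ (e ℤ.* y)
    ≡⟨ cong₂ (right X′) hW hz ⟨
  right X′ W Z
    ≡⟨ cong (λ X → right X W Z) hx ⟩
  right X W Z
    ≡⟨ cleared-right e c y x w z ⟩
  scale ℤ.* ((w ℤ.+ + 3 ℤ.* x ℤ.+ + 3 ℤ.* y ℤ.+ z) ℤ.* y) ∎)
  where
  open ≡-Reasoning
  e = + e′
  c = + c′
  k = x ℤ.* x ℤ.- y ℤ.* w
  P = (+ 1 ℤ.+ c) ℤ.* ((+ 1 ℤ.+ e) ℤ.* (+ 2 ℤ.+ e)) ℤ.* (+ 3 ℤ.+ e ℤ.+ c)
  X = (+ 1 ℤ.+ e) ℤ.* x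
  X′ = c ℤ.* y
  W = (+ 1 ℤ.+ e) ℤ.* ((+ 2 ℤ.+ e) ℤ.* w)
  W′ = (c ℤ.- + 1) ℤ.* (c ℤ.* y)
  Z = (+ 1 ℤ.+ c) ℤ.* z

  scale : ℤ
  scale = + 2 ℤ.* ((+ 1 ℤ.+ c) ℤ.* ((+ 1 ℤ.+ e) ℤ.* (+ 2 ℤ.+ e)))

  left right : ℤ → ℤ → ℤ → ℤ
  left X W Z = (+ 3 ℤ.+ e ℤ.+ c) ℤ.*
    ((+ 1 ℤ.+ c) ℤ.* (+ 2 ℤ.+ e) ℤ.* X ℤ.* y
     ℤ.+ + 2 ℤ.* (+ 1 ℤ.+ c) ℤ.* (+ 1 ℤ.+ e) ℤ.* (+ 2 ℤ.+ e) ℤ.* y ℤ.* y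
     ℤ.- W ℤ.* Z ℤ.- + 2 ℤ.* (+ 2 ℤ.+ e) ℤ.* X ℤ.* Z)
  right X W Z = + 2 ℤ.* y ℤ.*
    ((+ 1 ℤ.+ c) ℤ.* W ℤ.+ + 3 ℤ.* (+ 1 ℤ.+ c) ℤ.* (+ 2 ℤ.+ e) ℤ.* X
     ℤ.+ + 3 ℤ.* (+ 1 ℤ.+ c) ℤ.* (+ 1 ℤ.+ e) ℤ.* (+ 2 ℤ.+ e) ℤ.* y
     ℤ.+ (+ 1 ℤ.+ e) ℤ.* (+ 2 ℤ.+ e) ℤ.* Z)

  commute : ∀ a b x → a ℤ.* (b ℤ.* x) ≡ b ℤ.* (a ℤ.* x)
  commute = ℤ-Solver.solve-∀

  hW : W ≡ W′
  hW = begin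
    (+ 1 ℤ.+ e) ℤ.* ((+ 2 ℤ.+ e) ℤ.* w) ≡⟨ cong ((+ 1 ℤ.+ e) ℤ.*_) hw ⟨
    (+ 1 ℤ.+ e) ℤ.* ((c ℤ.- + 1) ℤ.* x) ≡⟨ commute (+ 1 ℤ.+ e) (c ℤ.- + 1) x ⟩
    (c ℤ.- + 1) ℤ.* ((+ 1 ℤ.+ e) ℤ.* x) ≡⟨ cong ((c ℤ.- + 1) ℤ.*_) hx ⟨
    (c ℤ.- + 1) ℤ.* (c ℤ.* y)           ∎

-- Counting the trees with an even number of long edges.

module LongEven (K : ℕ) (0<K : 0 < K) where
  open Long K 0<K

  shifted-HasSize : ∀ e c (m+1≡2K : suc (suc (e + c)) ≡ K + K) →
    ∃ λ t₃ → (Σ Tree (ShiftedClass (suc (e + c)) c m+1≡2K) HasSize t₃) ×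
      (+ t₃ ≡ ↓ (row (e + c)) c ℤ.* ↓ (row (e + c)) c ℤ.- row (e + c) c ℤ.* ↓ (↓ (row (e + c))) c)
  shifted-HasSize e zero m+1≡2K = 0 , empty-HasSize (λ { (_ , _ , ()) }) ,
    sym (cong (ℤ._-_ (+ 0)) (ℤₚ.*-zeroʳ (row (e + 0) 0)))
  shifted-HasSize e (suc c) m+1≡2K = forests 2 (e + suc c) true c ,
    ↔-trans (trees-HasSize (e + suc c) c)
      (same-↔ (TreeClass-irrelevant (suc (e + suc c)) c) (λ _ → ×-irrelevant ≡-irrelevant ≡-irrelevant)
        (λ _ (s , o) → s , cong suc o) (λ _ (s , o) → s , suc-injective o)) ,
    subst (λ M → + forests 2 M true c ≡ row M c ℤ.* row M c ℤ.- row M (suc c) ℤ.* ↓ (row M) c)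
      (sym (+-suc e c)) (trees-formula (suc e) c)

  longEven-count : ∀ e c → suc (suc (e + c)) ≡ K + K →
    ∃ λ f → (Σ Tree (λ t → TreeClass (suc (suc (e + c))) c t × longOdd t ≡ false) HasSize f) ×
      (3 + (e + c)) * f ≡ ((3 + (e + c)) C suc c) * ((e + c) C c)
  longEven-count e c m+1≡2K =
    let t₃ , size₃ , t₃-formula = shifted-HasSize e c m+1≡2K
        f , size-f , f-eq = longEven-HasSize (suc (e + c)) c m+1≡2K
          (trees-HasSize (suc (e + c)) c) (trees-HasSize (e + c) c) size₃
        f-eqℤ = begin
          + f ℤ.+ + f ℤ.+ (↓ (row (e + c)) c ℤ.* ↓ (row (e + c)) c ℤ.- row (e + c) c ℤ.* ↓ (↓ (row (e + c))) c)
            ≡⟨ cong (ℤ._+_ (+ f ℤ.+ + f)) t₃-formula ⟨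
          + (f + f + t₃)
            ≡⟨ cong +_ f-eq ⟩
          + forests 2 (suc (e + c)) true c ℤ.+ + forests 2 (e + c) true c
            ≡⟨ cong₂ ℤ._+_ (trees-suc-formula e c) (trees-formula e c) ⟩
          _ ∎
    in f , size-f , ℤₚ.+-injective (begin
      + ((3 + (e + c)) * f)
        ≡⟨ ℤₚ.pos-* (3 + (e + c)) f ⟩
      (+ 3 ℤ.+ + e ℤ.+ + c) ℤ.* + f
        ≡⟨ narayana-identity e c (↓ (↓ (row (e + c))) c) (↓ (row (e + c)) c) (row (e + c) c) (row (e + c) (suc c)) (+ f)
             (absorb-z e c) (absorb-x e c) (absorb-w e c) f-eqℤ ⟩
      _ ≡⟨ cong (ℤ._* row (e + c) c) (row-3 e c) ⟨
      row (3 + (e + c)) (suc c) ℤ.* row (e + c) c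
        ≡⟨ ℤₚ.pos-* ((3 + (e + c)) C suc c) ((e + c) C c) ⟨
      + (((3 + (e + c)) C suc c) * ((e + c) C c)) ∎)
    where open ≡-Reasoning

-- On unnormalised rationals equality is a cross-multiplication, which avoids reducing fractions. In
-- `mkℚᵘ` the second argument is the denominator minus one.
N₁-half : ∀ n c w → suc n * w ≡ (suc n C suc c) * ((n ∸ 1 ∸ 1) C c) → (+ w) / 1 ≡ N 1 n (suc c) *ℚ ½
N₁-half n c w e = ℚₚ.toℚᵘ-injective (begin
  ℚ.toℚᵘ ((+ w) / 1)
    ≈⟨ ℚₚ.toℚᵘ-fromℚᵘ (mkℚᵘ (+ w) 0) ⟩
  mkℚᵘ (+ w) 0
    ≈⟨ *≡* (trans (cross-multiply (+ w) (+ suc n)) (cong (λ k → (+ 2 ℤ.* k) ℤ.* + 1 ℤ.* + 1) X-eq)) ⟩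
  (mkℚᵘ (+ 2) n ℚᵘ.* mkℚᵘ X 0) ℚᵘ.* ℚᵘ.½
    ≈⟨ ℚᵘₚ.*-congʳ (ℚᵘₚ.*-cong (ℚₚ.toℚᵘ-fromℚᵘ (mkℚᵘ (+ 2) n)) (ℚₚ.toℚᵘ-fromℚᵘ (mkℚᵘ X 0))) ⟨
  (ℚ.toℚᵘ ((+ 2) / suc n) ℚᵘ.* ℚ.toℚᵘ (X / 1)) ℚᵘ.* ℚᵘ.½
    ≈⟨ ℚᵘₚ.*-congʳ (ℚₚ.toℚᵘ-homo-* ((+ 2) / suc n) (X / 1)) ⟨
  ℚ.toℚᵘ (N 1 n (suc c)) ℚᵘ.* ℚ.toℚᵘ ½
    ≈⟨ ℚₚ.toℚᵘ-homo-* (N 1 n (suc c)) ½ ⟨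
  ℚ.toℚᵘ (N 1 n (suc c) *ℚ ½) ∎)
  where
  open ℚᵘₚ.≃-Reasoning
  X = + ((suc n C suc c) * ((n ∸ 1 ∸ 1) C c))
  X-eq : + suc n ℤ.* + w ≡ X
  X-eq = trans (sym (ℤₚ.pos-* (suc n) w)) (cong +_ e)
  cross-multiply : ∀ w n → w ℤ.* ((n ℤ.* + 1) ℤ.* + 2) ≡ (+ 2 ℤ.* (n ℤ.* w)) ℤ.* + 1 ℤ.* + 1
  cross-multiply = ℤ-Solver.solve-∀

-- Non-crossing matchings as trees

end : ℕ → Tree → ℕ
end o leaf       = o
end o (node l r) = end (suc (end (suc o) l)) r

double-+ : ∀ a b → double (a + b) ≡ double a + double b
double-+ zero    b = refl
double-+ (suc a) b = cong (λ x → suc (suc x)) (double-+ a b)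

end≡ : ∀ o t → end o t ≡ o + double (size t)
end≡ o leaf       = sym (+-identityʳ o)
end≡ o (node l r) = begin
  end (suc (end (suc o) l)) r                              ≡⟨ end≡ _ r ⟩
  suc (end (suc o) l) + double (size r)                    ≡⟨ cong (λ q → suc q + double (size r)) (end≡ (suc o) l) ⟩
  suc (suc (o + double (size l))) + double (size r)        ≡⟨ lemma o (double (size l)) (double (size r)) ⟩
  o + suc (suc (double (size l) + double (size r)))        ≡⟨ cong (λ x → o + suc (suc x)) (double-+ (size l) (size r)) ⟨
  o + double (size (node l r))                             ∎
  where
  open ≡-Reasoning
  lemma : ∀ o a b → suc (suc (o + a)) + b ≡ o + suc (suc (a + b))
  lemma = ℕ-Solver.solve-∀

start≤end : ∀ o t → o ≤ end o t
start≤end o t = ≤-trans (m≤m+n o _) (≤-reflexive (sym (end≡ o t)))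

-- (Fits p o t): on the points from o onwards, p is the partner map of the
-- matching drawn by the bracket word t.
Fits : (ℕ → ℕ) → ℕ → Tree → Set
Fits p o leaf       = ⊤
Fits p o (node l r) = let q = end (suc o) l in p o ≡ q × p q ≡ o × Fits p (suc o) l × Fits p (suc q) r

-- Membership in the interval from `o` up to `end o t`, in a form that records the place of the
-- point in the tree; statements about partners are then proved by recursion on this place.
data In : ℕ → Tree → ℕ → Set where
  opening : ∀ {o l r} → In o (node l r) o
  closing : ∀ {o l r} → In o (node l r) (end (suc o) l)
  inner   : ∀ {o l r i} → In (suc o) l i → In o (node l r) i
  after   : ∀ {o l r i} → In (suc (end (suc o) l)) r i → In o (node l r) i

In-lower : ∀ {o t i} → In o t i → o ≤ i
In-lower opening   = ≤-refl
In-lower (closing {o} {l}) = <⇒≤ (start≤end (suc o) l)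
In-lower (inner x) = <⇒≤ (In-lower x)
In-lower (after {o} {l} x) = ≤-trans (<⇒≤ (start≤end (suc o) l)) (<⇒≤ (In-lower x))

In-upper : ∀ {o t i} → In o t i → i < end o t
In-upper (opening {o} {l} {r}) = ≤-trans (m≤n⇒m≤1+n (start≤end (suc o) l)) (start≤end (suc (end (suc o) l)) r)
In-upper (closing {o} {l} {r}) = start≤end (suc (end (suc o) l)) r
In-upper (inner {o} {l} {r} x) = ≤-trans (m≤n⇒m≤1+n (In-upper x)) (start≤end (suc (end (suc o) l)) r)
In-upper (after x) = In-upper x

In-complete : ∀ o t i → o ≤ i → i < end o t → In o t i
In-complete o leaf i o≤i i<o = contradiction o≤i (<⇒≱ i<o)
In-complete o (node l r) i o≤i i<e with <-cmp o i
... | tri> _ _ i<o  = contradiction o≤i (<⇒≱ i<o)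
... | tri≈ _ refl _ = opening
... | tri< o<i _ _ with <-cmp i (end (suc o) l)
...   | tri< i<q _ _  = inner (In-complete (suc o) l i o<i i<q)
...   | tri≈ _ refl _ = closing
...   | tri> _ _ q<i  = after (In-complete _ r i q<i i<e)

Fits-In : ∀ {p o t i} → Fits p o t → In o t i → In o t (p i)
Fits-In (po , pq , fl , fr) opening   = subst (In _ _) (sym po) closing
Fits-In (po , pq , fl , fr) closing   = subst (In _ _) (sym pq) opening
Fits-In (po , pq , fl , fr) (inner x) = inner (Fits-In fl x)
Fits-In (po , pq , fl , fr) (after x) = after (Fits-In fr x)

Fits-involutive : ∀ {p o t i} → Fits p o t → In o t i → p (p i) ≡ i
Fits-involutive {p} (po , pq , fl , fr) opening   = trans (cong p po) pq
Fits-involutive {p} (po , pq , fl , fr) closing   = trans (cong p pq) po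
Fits-involutive     (po , pq , fl , fr) (inner x) = Fits-involutive fl x
Fits-involutive     (po , pq , fl , fr) (after x) = Fits-involutive fr x

Fits-irreflexive : ∀ {p o t i} → Fits p o t → In o t i → p i ≢ i
Fits-irreflexive {o = o} {node l r} (po , pq , fl , fr) opening e =
  <⇒≢ (start≤end (suc o) l) (trans (sym e) po)
Fits-irreflexive {o = o} {node l r} (po , pq , fl , fr) closing e =
  <⇒≢ (start≤end (suc o) l) (trans (sym pq) e)
Fits-irreflexive (po , pq , fl , fr) (inner x) = Fits-irreflexive fl x
Fits-irreflexive (po , pq , fl , fr) (after x) = Fits-irreflexive fr x

Fits-noncrossing : ∀ {p o t x y} → Fits p o t → In o t x → In o t y →
  x < y → y < p x → ¬ p x < p y
Fits-noncrossing (po , pq , fl , fr) opening opening x<y y<px px<py = <-irrefl refl x<y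
Fits-noncrossing (po , pq , fl , fr) opening closing x<y y<px px<py = <-irrefl (sym po) y<px
Fits-noncrossing (po , pq , fl , fr) opening (inner y) x<y y<px px<py =
  <-asym px<py (subst (_ <_) (sym po) (In-upper (Fits-In fl y)))
Fits-noncrossing (po , pq , fl , fr) opening (after y) x<y y<px px<py =
  <-asym (subst (_ <_) po y<px) (In-lower y)
Fits-noncrossing {o = o} {node l r} (po , pq , fl , fr) closing y x<y y<px px<py =
  <⇒≱ (subst (_ <_) pq y<px) (In-lower y)
Fits-noncrossing (po , pq , fl , fr) (inner x) opening x<y y<px px<py = <-asym x<y (In-lower x)
Fits-noncrossing (po , pq , fl , fr) (inner x) closing x<y y<px px<py = <-asym y<px (In-upper (Fits-In fl x))
Fits-noncrossing (po , pq , fl , fr) (inner x) (inner y) = Fits-noncrossing fl x y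
Fits-noncrossing (po , pq , fl , fr) (inner x) (after y) x<y y<px px<py =
  <-asym (<-trans y<px (In-upper (Fits-In fl x))) (In-lower y)
Fits-noncrossing {o = o} {node l r} (po , pq , fl , fr) (after x) opening x<y y<px px<py =
  <⇒≱ x<y (In-lower (after {o} {l} {r} x))
Fits-noncrossing (po , pq , fl , fr) (after x) closing x<y y<px px<py = <-asym x<y (In-lower x)
Fits-noncrossing (po , pq , fl , fr) (after x) (inner y) x<y y<px px<py =
  <-asym (<-trans x<y (In-upper y)) (In-lower x)
Fits-noncrossing (po , pq , fl , fr) (after x) (after y) = Fits-noncrossing fr x y

Fits-agree : ∀ {p p′ o t i} → Fits p o t → Fits p′ o t → In o t i → p i ≡ p′ i
Fits-agree (po , pq , fl , fr) (po′ , pq′ , fl′ , fr′) opening   = trans po (sym po′)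
Fits-agree (po , pq , fl , fr) (po′ , pq′ , fl′ , fr′) closing   = trans pq (sym pq′)
Fits-agree (po , pq , fl , fr) (po′ , pq′ , fl′ , fr′) (inner x) = Fits-agree fl fl′ x
Fits-agree (po , pq , fl , fr) (po′ , pq′ , fl′ , fr′) (after x) = Fits-agree fr fr′ x

Fits-cong : ∀ {p p′ o} t → (∀ i → In o t i → p i ≡ p′ i) → Fits p o t → Fits p′ o t
Fits-cong leaf       agree _ = tt
Fits-cong (node l r) agree (po , pq , fl , fr) =
  trans (sym (agree _ opening)) po , trans (sym (agree _ closing)) pq ,
  Fits-cong l (λ i x → agree i (inner x)) fl , Fits-cong r (λ i x → agree i (after x)) fr

-- The partner of the first point is the position where the left subtree ends, so `p` fixes the ends
-- of both subtrees.
Fits-unique : ∀ {p o} t t′ → Fits p o t → Fits p o t′ → end o t ≡ end o t′ → t ≡ t′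
Fits-unique leaf leaf _ _ _ = refl
Fits-unique {o = o} leaf (node l r) _ _ e = contradiction e (<⇒≢ (In-upper (opening {o} {l} {r})))
Fits-unique {o = o} (node l r) leaf _ _ e = contradiction (sym e) (<⇒≢ (In-upper (opening {o} {l} {r})))
Fits-unique (node l r) (node l′ r′) (po , pq , fl , fr) (po′ , pq′ , fl′ , fr′) e
  with refl ← Fits-unique l l′ fl fl′ (trans (sym po) po′) = cong (node l) (Fits-unique r r′ fr fr′ e)

mate : ℕ → Tree → ℕ → ℕ
mate o leaf       i = i
mate o (node l r) i =
  let q = end (suc o) l in
  if does (i ≟ o) then q else if does (i ≟ q) then o else
  if does (i <? q) then mate (suc o) l i else mate (suc q) r i

mate-opening : ∀ o l r → mate o (node l r) o ≡ end (suc o) l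
mate-opening o l r rewrite dec-true (o ≟ o) refl = refl

mate-closing : ∀ o l r → mate o (node l r) (end (suc o) l) ≡ o
mate-closing o l r
  rewrite dec-false (end (suc o) l ≟ o) (≢-sym (<⇒≢ (start≤end (suc o) l)))
        | dec-true (end (suc o) l ≟ end (suc o) l) refl = refl

mate-inner : ∀ o l r i → In (suc o) l i → mate (suc o) l i ≡ mate o (node l r) i
mate-inner o l r i x
  rewrite dec-false (i ≟ o) (≢-sym (<⇒≢ (In-lower x)))
        | dec-false (i ≟ end (suc o) l) (<⇒≢ (In-upper x))
        | dec-true (i <? end (suc o) l) (In-upper x) = refl

mate-after : ∀ o l r i → In (suc (end (suc o) l)) r i → mate (suc (end (suc o) l)) r i ≡ mate o (node l r) i
mate-after o l r i x
  rewrite dec-false (i ≟ o) (≢-sym (<⇒≢ (<-trans (start≤end (suc o) l) (In-lower x))))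
        | dec-false (i ≟ end (suc o) l) (≢-sym (<⇒≢ (In-lower x)))
        | dec-false (i <? end (suc o) l) (<-asym (In-lower x)) = refl

mate-Fits : ∀ o t → Fits (mate o t) o t
mate-Fits o leaf       = tt
mate-Fits o (node l r) =
  mate-opening o l r , mate-closing o l r ,
  Fits-cong l (mate-inner o l r) (mate-Fits (suc o) l) ,
  Fits-cong r (mate-after o l r) (mate-Fits _ r)

record NoncrossingMatching (m : ℕ) (p : ℕ → ℕ) : Set where
  field
    bounded     : ∀ {i} → i < m → p i < m
    involutive  : ∀ {i} → i < m → p (p i) ≡ i
    irreflexive : ∀ {i} → i < m → p i ≢ i
    noncrossing : ∀ {x y} → x < m → y < m → x < y → y < p x → ¬ p x < p y

Fits⇒NoncrossingMatching : ∀ {p} t → Fits p 0 t → NoncrossingMatching (end 0 t) p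
Fits⇒NoncrossingMatching t f = record
  { bounded     = λ i<m → In-upper (Fits-In f (In-complete 0 t _ z≤n i<m))
  ; involutive  = λ i<m → Fits-involutive f (In-complete 0 t _ z≤n i<m)
  ; irreflexive = λ i<m → Fits-irreflexive f (In-complete 0 t _ z≤n i<m)
  ; noncrossing = λ x<m y<m → Fits-noncrossing f (In-complete 0 t _ z≤n x<m) (In-complete 0 t _ z≤n y<m)
  }

module _ {m : ℕ} {p : ℕ → ℕ} (M : NoncrossingMatching m p) where
  open NoncrossingMatching M

  Closed : ℕ → ℕ → Set
  Closed s e = ∀ {i} → s ≤ i → i < e → s ≤ p i × p i < e

  -- The edge from `s` to `p s` cuts a block closed under `p` into the points inside and the points
  -- after it; since nothing crosses this edge, both are closed again. `k` bounds the length of the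
  -- block.
  parse : ∀ k s e → e ≤ s + k → s ≤ e → e ≤ m → Closed s e → Σ Tree λ t → Fits p s t × end s t ≡ e
  parse k s e e≤s+k s≤e e≤m closed with s ≟ e
  parse k s e e≤s+k s≤e e≤m closed | yes s≡e = leaf , tt , s≡e
  parse zero s e e≤s+k s≤e e≤m closed | no s≢e =
    contradiction (≤-antisym s≤e (≤-trans e≤s+k (≤-reflexive (+-identityʳ s)))) s≢e
  parse (suc k) s e e≤s+k s≤e e≤m closed | no s≢e = result
    where
    s<e : s < e
    s<e = ≤∧≢⇒< s≤e s≢e

    s<m : s < m
    s<m = ≤-trans s<e e≤m

    s<ps : s < p s
    s<ps = ≤∧≢⇒< (proj₁ (closed ≤-refl s<e)) (≢-sym (irreflexive s<m))

    ps<e : p s < e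
    ps<e = proj₂ (closed ≤-refl s<e)

    e≤1+s+k : e ≤ suc (s + k)
    e≤1+s+k = ≤-trans e≤s+k (≤-reflexive (+-suc s k))

    closed-inner : Closed (suc s) (p s)
    closed-inner {i} s<i i<ps =
      ≤∧≢⇒< (proj₁ closed-i) (λ s≡pi → <⇒≢ i<ps (trans (sym (involutive i<m)) (cong p (sym s≡pi)))) ,
      ≤∧≢⇒< (≮⇒≥ (noncrossing s<m i<m s<i i<ps))
            (λ pi≡ps → <⇒≢ s<i (trans (sym (involutive s<m)) (trans (cong p (sym pi≡ps)) (involutive i<m))))
      where
      i<e = <-trans i<ps ps<e
      i<m = ≤-trans i<e e≤m
      closed-i = closed (<⇒≤ s<i) i<e

    closed-after : Closed (suc (p s)) e
    closed-after {i} ps<i i<e = ≰⇒> pi≰ps , proj₂ closed-i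
      where
      i<m = ≤-trans i<e e≤m
      closed-i = closed (<⇒≤ (<-trans s<ps ps<i)) i<e

      pi≰ps : ¬ p i ≤ p s
      pi≰ps pi≤ps with p i ≟ p s | p i ≟ s
      ... | yes pi≡ps | _ =
        <-asym (subst (_< i) (sym pi≡ps) ps<i)
               (subst (_< p i) (trans (sym (involutive s<m)) (trans (cong p (sym pi≡ps)) (involutive i<m)))
                      (subst (s <_) (sym pi≡ps) s<ps))
      ... | no _ | yes pi≡s = <⇒≢ ps<i (trans (cong p (sym pi≡s)) (involutive i<m))
      -- Here `p i` lies strictly between `s` and `p s`, while its partner `i` lies beyond `p s`:
      -- the two edges cross.
      ... | no pi≢ps | no pi≢s =
        noncrossing s<m (≤-trans (proj₂ closed-i) e≤m)
          (≤∧≢⇒< (proj₁ closed-i) (≢-sym pi≢s)) (≤∧≢⇒< pi≤ps pi≢ps)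
          (subst (p s <_) (sym (involutive i<m)) ps<i)

    result : Σ Tree λ t → Fits p s t × end s t ≡ e
    result with parse k (suc s) (p s) (≤-trans (<⇒≤ ps<e) e≤1+s+k) s<ps (≤-trans (<⇒≤ ps<e) e≤m) closed-inner
              | parse k (suc (p s)) e (≤-trans e≤1+s+k (s≤s (+-monoˡ-≤ k (<⇒≤ s<ps)))) ps<e e≤m closed-after
    ... | l , fl , end-l | r , fr , end-r rewrite sym end-l =
      node l r , (sym end-l′ , trans (cong p end-l′) (involutive s<m) , fl , fr) , end-r
      where end-l′ = end-l

  NoncrossingMatching⇒Fits : Σ Tree λ t → Fits p 0 t × end 0 t ≡ m
  NoncrossingMatching⇒Fits = parse m 0 m ≤-refl z≤n ≤-refl (λ _ i<m → z≤n , bounded i<m)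

-- Sums over consecutive points, for counts and for weights.

module Range {A : Set} (_⊕_ : A → A → A) (ε : A)
  (assoc : ∀ x y z → (x ⊕ y) ⊕ z ≡ x ⊕ (y ⊕ z)) (identityˡ : ∀ x → ε ⊕ x ≡ x) where

  rangeSum : ℕ → ℕ → (ℕ → A) → A
  rangeSum a zero    f = ε
  rangeSum a (suc k) f = f a ⊕ rangeSum (suc a) k f

  rangeSum-+ : ∀ a j k f → rangeSum a (j + k) f ≡ rangeSum a j f ⊕ rangeSum (a + j) k f
  rangeSum-+ a zero    k f = trans (cong (λ b → rangeSum b k f) (sym (+-identityʳ a))) (sym (identityˡ _))
  rangeSum-+ a (suc j) k f = begin
    f a ⊕ rangeSum (suc a) (j + k) f
      ≡⟨ cong (f a ⊕_) (rangeSum-+ (suc a) j k f) ⟩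
    f a ⊕ (rangeSum (suc a) j f ⊕ rangeSum (suc a + j) k f)
      ≡⟨ assoc _ _ _ ⟨
    (f a ⊕ rangeSum (suc a) j f) ⊕ rangeSum (suc a + j) k f
      ≡⟨ cong (λ b → (f a ⊕ rangeSum (suc a) j f) ⊕ rangeSum b k f) (+-suc a j) ⟨
    (f a ⊕ rangeSum (suc a) j f) ⊕ rangeSum (a + suc j) k f ∎
    where open ≡-Reasoning

  rangeSum-cong : ∀ a k {f g} → (∀ i → a ≤ i → i < a + k → f i ≡ g i) → rangeSum a k f ≡ rangeSum a k g
  rangeSum-cong a zero    f≗g = refl
  rangeSum-cong a (suc k) f≗g = cong₂ _⊕_ (f≗g a ≤-refl (m<m+n a (s≤s z≤n)))
    (rangeSum-cong (suc a) k λ i a<i i<a+k → f≗g i (<⇒≤ a<i) (≤-trans i<a+k (≤-reflexive (sym (+-suc a k)))))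

  rangeSum-ε : ∀ a k {f} → (∀ i → a ≤ i → i < a + k → f i ≡ ε) → rangeSum a k f ≡ ε
  rangeSum-ε a k f≗ε = trans (rangeSum-cong a k f≗ε) (constant a k)
    where
    constant : ∀ a k → rangeSum a k (λ _ → ε) ≡ ε
    constant a zero    = refl
    constant a (suc k) = trans (identityˡ _) (constant (suc a) k)

  foldr-tabulate : ∀ k (f : Fin k → A) a {g} → (∀ x → f x ≡ g (a + toℕ x)) →
    foldr _⊕_ ε (List.tabulate f) ≡ rangeSum a k g
  foldr-tabulate zero    f a     f≗g = refl
  foldr-tabulate (suc k) f a {g} f≗g = cong₂ _⊕_ (trans (f≗g zero) (cong g (+-identityʳ a)))
    (foldr-tabulate k (f ∘ suc) (suc a) λ x → trans (f≗g (suc x)) (cong g (+-suc a (toℕ x))))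

  treeSum : (ℕ → ℕ → A) → ℕ → Tree → A
  treeSum f o leaf       = ε
  treeSum f o (node l r) =
    let q = end (suc o) l in f o q ⊕ (treeSum f (suc o) l ⊕ (f q o ⊕ treeSum f (suc q) r))

  rangeSum-Fits : ∀ {p} f o t → Fits p o t → rangeSum o (double (size t)) (λ i → f i (p i)) ≡ treeSum f o t
  rangeSum-Fits {p} f o leaf       _ = refl
  rangeSum-Fits {p} f o (node l r) (po , pq , fl , fr) = begin
    g o ⊕ rangeSum (suc o) (suc (double (size l + size r))) g
      ≡⟨ cong (λ k → g o ⊕ rangeSum (suc o) k g)
           (trans (cong suc (double-+ (size l) (size r))) (sym (+-suc (double (size l)) (double (size r))))) ⟩
    g o ⊕ rangeSum (suc o) (double (size l) + suc (double (size r))) g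
      ≡⟨ cong (g o ⊕_) (rangeSum-+ (suc o) (double (size l)) _ g) ⟩
    g o ⊕ (rangeSum (suc o) (double (size l)) g ⊕ rangeSum (suc o + double (size l)) (suc (double (size r))) g)
      ≡⟨ cong (λ q → g o ⊕ (rangeSum (suc o) (double (size l)) g ⊕ rangeSum q (suc (double (size r))) g))
           (end≡ (suc o) l) ⟨
    g o ⊕ (rangeSum (suc o) (double (size l)) g ⊕ (g q ⊕ rangeSum (suc q) (double (size r)) g))
      ≡⟨ cong₂ (λ x y → g o ⊕ (x ⊕ (g q ⊕ y))) (rangeSum-Fits f (suc o) l fl) (rangeSum-Fits f (suc q) r fr) ⟩
    g o ⊕ (treeSum f (suc o) l ⊕ (g q ⊕ treeSum f (suc q) r))
      ≡⟨ cong₂ (λ x y → f o x ⊕ (treeSum f (suc o) l ⊕ (f q y ⊕ treeSum f (suc q) r))) po pq ⟩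
    f o q ⊕ (treeSum f (suc o) l ⊕ (f q o ⊕ treeSum f (suc q) r)) ∎
    where
    open ≡-Reasoning
    q = end (suc o) l
    g = λ i → f i (p i)

module ℕ-Range = Range _+_ 0 +-assoc +-identityˡ
module ℤ-Range = Range ℤ._+_ (+ 0) ℤₚ.+-assoc ℤₚ.+-identityˡ

open ℕ-Range

<ᵇ-true : ∀ {m n} → m < n → (m <ᵇ n) ≡ true
<ᵇ-true = ≤ᵇ-true

<ᵇ-false : ∀ {m n} → n ≤ m → (m <ᵇ n) ≡ false
<ᵇ-false n≤m = ≤ᵇ-false (s≤s n≤m)

-- Each edge passes the test at its left end and fails it at its right end.
openings-size : ∀ {p} o t → Fits p o t → rangeSum o (double (size t)) (λ i → bit (i <ᵇ p i)) ≡ size t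
openings-size o t f = trans (rangeSum-Fits (λ i j → bit (i <ᵇ j)) o t f) (lemma o t)
  where
  lemma : ∀ o t → treeSum (λ i j → bit (i <ᵇ j)) o t ≡ size t
  lemma o leaf       = refl
  lemma o (node l r)
    rewrite <ᵇ-true (start≤end (suc o) l) | <ᵇ-false (<⇒≤ (start≤end (suc o) l)) =
    cong suc (cong₂ _+_ (lemma (suc o) l) (lemma _ r))

length-filter-tabulate : ∀ {A : Set} k (f : Fin k → A) (q : A → Bool) a {g} →
  (∀ x → q (f x) ≡ g (a + toℕ x)) →
  length (filterᵇ q (List.tabulate f)) ≡ rangeSum a k (bit ∘ g)
length-filter-tabulate zero    f q a     q≗g = refl
length-filter-tabulate (suc k) f q a {g} q≗g
  with q (f zero) in eq | length-filter-tabulate k (f ∘ suc) q (suc a) {g} (λ x → trans (q≗g (suc x)) (cong g (+-suc a (toℕ x))))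
... | true  | ih = cong₂ _+_ (cong bit (trans (sym eq) (trans (q≗g zero) (cong g (+-identityʳ a))))) ih
... | false | ih = cong₂ _+_ (cong bit (trans (sym eq) (trans (q≗g zero) (cong g (+-identityʳ a))))) ih

countᶠ-rangeSum : ∀ {m} (q : Fin m → Bool) {g} → (∀ x → q x ≡ g (toℕ x)) → countᶠ q ≡ rangeSum 0 m (bit ∘ g)
countᶠ-rangeSum {m} q q≗g = length-filter-tabulate m id q 0 q≗g

sumℤ-rangeSum : ∀ {m} (f : Fin m → ℤ) {g} → (∀ x → f x ≡ g (toℕ x)) → sumℤ f ≡ ℤ-Range.rangeSum 0 m g
sumℤ-rangeSum {m} f f≗g =
  trans (cong (foldr ℤ._+_ (+ 0)) (map-tabulate {n = m} id f)) (ℤ-Range.foldr-tabulate m f 0 f≗g)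

-- Boolean tests on `Fin` and statements about point numbers.

and-tabulate⁻ : ∀ k (q : Fin k → Bool) → T (and (List.tabulate q)) → ∀ x → T (q x)
and-tabulate⁻ (suc k) q t zero    = proj₁ (Equivalence.to T-∧ t)
and-tabulate⁻ (suc k) q t (suc x) = and-tabulate⁻ k (q ∘ suc) (proj₂ (Equivalence.to T-∧ t)) x

and-tabulate⁺ : ∀ k (q : Fin k → Bool) → (∀ x → T (q x)) → T (and (List.tabulate q))
and-tabulate⁺ zero    q t = tt
and-tabulate⁺ (suc k) q t = Equivalence.from T-∧ (t zero , and-tabulate⁺ k (q ∘ suc) (t ∘ suc))

allᶠ⁻ : ∀ {m} (q : Fin m → Bool) → T (allᶠ q) → ∀ x → T (q x)
allᶠ⁻ {m} q t = and-tabulate⁻ m q (subst (T ∘ and) (map-tabulate {n = m} id q) t)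

allᶠ⁺ : ∀ {m} (q : Fin m → Bool) → (∀ x → T (q x)) → T (allᶠ q)
allᶠ⁺ {m} q t = subst (T ∘ and) (sym (map-tabulate {n = m} id q)) (and-tabulate⁺ m q t)

T-not⁻ : ∀ {b} → T (not b) → ¬ T b
T-not⁻ {false} _ ()

T-not⁺ : ∀ {b} → ¬ T b → T (not b)
T-not⁺ {false} _  = tt
T-not⁺ {true}  ¬t = ¬t tt

-- A partner map on plain numbers lets positions be shifted and compared freely along a bracket
-- word; 0 is a default value beyond the end of the vector.
nth : ∀ {m k} → Vec (Fin m) k → ℕ → ℕ
nth []       i       = 0
nth (x ∷ xs) zero    = toℕ x
nth (x ∷ xs) (suc i) = nth xs i

nth-lookup : ∀ {m k} (v : Vec (Fin m) k) x → nth v (toℕ x) ≡ toℕ (lookup v x)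
nth-lookup (y ∷ v) zero    = refl
nth-lookup (y ∷ v) (suc x) = nth-lookup v x

nth-injective : ∀ {m k} (v v′ : Vec (Fin m) k) → (∀ {i} → i < k → nth v i ≡ nth v′ i) → v ≡ v′
nth-injective []      []        e = refl
nth-injective (x ∷ v) (x′ ∷ v′) e =
  cong₂ _∷_ (toℕ-injective (e (s≤s z≤n))) (nth-injective v v′ (λ i<k → e (s≤s i<k)))

forall-toℕ : ∀ {m} (P : ℕ → Set) → (∀ (x : Fin m) → P (toℕ x)) → ∀ {i} → i < m → P i
forall-toℕ P h i<m = subst P (toℕ-fromℕ< i<m) (h (fromℕ< i<m))

tabulate-nth : ∀ {m} (p : ℕ → ℕ) → (∀ {i} → i < m → p i < m) →
  Σ (Vec (Fin m) m) λ v → ∀ {i} → i < m → nth v i ≡ p i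
tabulate-nth {m} p bounded = v , forall-toℕ (λ i → nth v i ≡ p i) λ x →
    trans (nth-lookup v x) (trans (cong toℕ (lookup∘tabulate f x)) (toℕ-fromℕ< _))
  where
  f : Fin m → Fin m
  f x = fromℕ< (bounded (toℕ<n x))
  v = tabulate f

isMatching⇒NoncrossingMatching : ∀ {m} (v : Matching m) → T (isPerfectMatching v) → T (isNonCrossing v) →
  NoncrossingMatching m (nth v)
isMatching⇒NoncrossingMatching {m} v perfect nc = record
  { bounded     = forall-toℕ (λ i → nth v i < m) λ x → subst (_< m) (sym (nth-lookup v x)) (toℕ<n _)
  ; involutive  = forall-toℕ (λ i → nth v (nth v i) ≡ i) λ x →
      trans (cong (nth v) (nth-lookup v x)) (trans (nth-lookup v (lookup v x))
        (≡ᵇ⇒≡ _ _ (proj₁ (Equivalence.to T-∧ (allᶠ⁻ _ perfect x)))))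
  ; irreflexive = forall-toℕ (λ i → nth v i ≢ i) λ x e →
      T-not⁻ (proj₂ (Equivalence.to T-∧ (allᶠ⁻ _ perfect x)))
        (≡⇒≡ᵇ _ _ (trans (sym (nth-lookup v x)) e))
  ; noncrossing = λ {x} {y} x<m → forall-toℕ (λ y → x < y → y < nth v x → ¬ nth v x < nth v y)
      (λ y → forall-toℕ (λ x → x < toℕ y → toℕ y < nth v x → ¬ nth v x < nth v (toℕ y))
        (λ x x<y y<px px<py → T-not⁻ (allᶠ⁻ _ (allᶠ⁻ _ nc x) y)
          (Equivalence.from T-∧ (<⇒<ᵇ x<y , Equivalence.from T-∧
            (<⇒<ᵇ (subst (toℕ y <_) (nth-lookup v x) y<px) ,
             <⇒<ᵇ (subst₂ _<_ (nth-lookup v x) (nth-lookup v y) px<py))))) x<m)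
  }

NoncrossingMatching⇒isMatching : ∀ {m} (v : Matching m) → NoncrossingMatching m (nth v) →
  T (isPerfectMatching v) × T (isNonCrossing v)
NoncrossingMatching⇒isMatching v M =
  allᶠ⁺ _ (λ x → Equivalence.from T-∧
    (≡⇒≡ᵇ _ _ (trans (sym (trans (cong (nth v) (nth-lookup v x)) (nth-lookup v (lookup v x)))) (involutive (toℕ<n x))) ,
     T-not⁺ λ e → irreflexive (toℕ<n x) (trans (nth-lookup v x) (≡ᵇ⇒≡ _ _ e)))) ,
  allᶠ⁺ _ (λ x → allᶠ⁺ _ λ y → T-not⁺ λ e →
    let x<y , e′ = Equivalence.to T-∧ e ; y<px , px<py = Equivalence.to T-∧ e′
    in noncrossing (toℕ<n x) (toℕ<n y) (<ᵇ⇒< _ _ x<y)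
         (subst (toℕ y <_) (sym (nth-lookup v x)) (<ᵇ⇒< _ _ y<px))
         (subst₂ _<_ (sym (nth-lookup v x)) (sym (nth-lookup v y)) (<ᵇ⇒< _ _ px<py)))
  where open NoncrossingMatching M

-- Lengths, signs and weights

-- cwGap, onArc and edgesOnSide in terms of point numbers.
gap : ℕ → ℕ → ℕ → ℕ
gap m x y = if x ≤ᵇ y then y ∸ x else (m + y) ∸ x

arc : ℕ → ℕ → ℕ → ℕ → Bool
arc m s t z = (0 <ᵇ gap m s z) ∧ (gap m s z <ᵇ gap m s t)

sideTerm : ℕ → ℕ → ℕ → ℕ → ℕ → Bool
sideTerm m s t z z′ = (z <ᵇ z′) ∧ arc m s t z ∧ arc m s t z′

side : ℕ → (ℕ → ℕ) → ℕ → ℕ → ℕ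
side m p s t = rangeSum 0 m (λ z → bit (sideTerm m s t z (p z)))

edgesOnSide-side : ∀ {m} (v : Matching m) s t → edgesOnSide v s t ≡ side m (nth v) (toℕ s) (toℕ t)
edgesOnSide-side {m} v s t = countᶠ-rangeSum _
  λ y → cong (sideTerm m (toℕ s) (toℕ t) (toℕ y)) (sym (nth-lookup v y))

gap-≤ : ∀ m {x y} → x ≤ y → gap m x y ≡ y ∸ x
gap-≤ m x≤y rewrite ≤ᵇ-true x≤y = refl

gap-> : ∀ m {x y} → y < x → gap m x y ≡ (m + y) ∸ x
gap-> m y<x rewrite ≤ᵇ-false y<x = refl

arc-true : ∀ {m s t z} → 0 < gap m s z → gap m s z < gap m s t → arc m s t z ≡ true
arc-true 0<g g<h rewrite <ᵇ-true 0<g | <ᵇ-true g<h = refl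

arc-false : ∀ {m s t z} → gap m s t ≤ gap m s z → arc m s t z ≡ false
arc-false {m} {s} {t} {z} h≤g rewrite <ᵇ-false h≤g = ∧-zeroʳ _

arc-start : ∀ m s t → arc m s t s ≡ false
arc-start m s t rewrite gap-≤ m (≤-refl {s}) | n∸n≡0 s = refl

module Arcs (m s t : ℕ) (s<t : s < t) (t<m : t < m) where
  Inside Outside : ℕ → Set
  Inside z = s < z × z < t
  Outside z = z < s ⊎ t < z

  arc-inside : ∀ {z} → Inside z → arc m s t z ≡ true
  arc-inside {z} (s<z , z<t) = arc-true {m} {s} {t} {z}
    (subst (0 <_) (sym (gap-≤ m (<⇒≤ s<z))) (m<n⇒0<n∸m s<z))
    (subst₂ _<_ (sym (gap-≤ m (<⇒≤ s<z))) (sym (gap-≤ m (<⇒≤ s<t))) (∸-monoˡ-< z<t (<⇒≤ s<z)))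

  arc-end : arc m s t t ≡ false
  arc-end = arc-false {m} {s} {t} {t} ≤-refl

  arc-outside : ∀ {z} → Outside z → arc m s t z ≡ false
  arc-outside {z} (inj₁ z<s) = arc-false {m} {s} {t} {z}
    (subst₂ _≤_ (sym (gap-≤ m (<⇒≤ s<t))) (sym (gap-> m z<s)) (∸-monoˡ-≤ s (≤-trans (<⇒≤ t<m) (m≤m+n m z))))
  arc-outside {z} (inj₂ t<z) = arc-false {m} {s} {t} {z}
    (subst₂ _≤_ (sym (gap-≤ m (<⇒≤ s<t))) (sym (gap-≤ m (<⇒≤ (<-trans s<t t<z)))) (∸-monoˡ-≤ s (<⇒≤ t<z)))

  coarc-outside : ∀ {z} → z < m → Outside z → arc m t s z ≡ true
  coarc-outside {z} z<m (inj₁ z<s) = arc-true {m} {t} {s} {z}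
    (subst (0 <_) (sym (gap-> m (<-trans z<s s<t))) (m<n⇒0<n∸m t<m+z))
    (subst₂ _<_ (sym (gap-> m (<-trans z<s s<t))) (sym (gap-> m s<t))
      (∸-monoˡ-< (+-monoʳ-< m z<s) (<⇒≤ t<m+z)))
    where
    t<m+z : t < m + z
    t<m+z = ≤-trans t<m (m≤m+n m z)
  coarc-outside {z} z<m (inj₂ t<z) = arc-true {m} {t} {s} {z}
    (subst (0 <_) (sym (gap-≤ m (<⇒≤ t<z))) (m<n⇒0<n∸m t<z))
    (subst₂ _<_ (sym (gap-≤ m (<⇒≤ t<z))) (sym (gap-> m s<t))
      (∸-monoˡ-< (≤-trans z<m (m≤m+n m s)) (<⇒≤ t<z)))

  coarc-inside : ∀ {z} → s ≤ z → z < t → arc m t s z ≡ false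
  coarc-inside {z} s≤z z<t = arc-false {m} {t} {s} {z}
    (subst₂ _≤_ (sym (gap-> m s<t)) (sym (gap-> m z<t)) (∸-monoˡ-≤ t (+-monoʳ-≤ m s≤z)))

double-mono-≤ : ∀ {a b} → a ≤ b → double a ≤ double b
double-mono-≤ z≤n       = z≤n
double-mono-≤ (s≤s a≤b) = s≤s (s≤s (double-mono-≤ a≤b))

double≡+ : ∀ a → double a ≡ a + a
double≡+ zero    = refl
double≡+ (suc a) = cong suc (trans (cong suc (double≡+ a)) (sym (+-suc a a)))

module Edges (K n m : ℕ) (0<K : 0 < K) (n≡2K : n ≡ K + K) (m≡2n : m ≡ double n)
             {p : ℕ → ℕ} (t : Tree) (fits : Fits p 0 t) (size-t : size t ≡ n) where

  matching : NoncrossingMatching m p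
  matching = subst (λ m → NoncrossingMatching m p) end-t (Fits⇒NoncrossingMatching t fits)
    where
    end-t : end 0 t ≡ m
    end-t = trans (end≡ 0 t) (trans (cong double size-t) (sym m≡2n))

  open NoncrossingMatching matching

  openings-total : rangeSum 0 m (λ z → bit (z <ᵇ p z)) ≡ n
  openings-total = begin
    rangeSum 0 m (λ z → bit (z <ᵇ p z))
      ≡⟨ cong (λ k → rangeSum 0 k (λ z → bit (z <ᵇ p z))) (trans m≡2n (cong double (sym size-t))) ⟩
    rangeSum 0 (double (size t)) (λ z → bit (z <ᵇ p z))
      ≡⟨ openings-size 0 t fits ⟩
    size t
      ≡⟨ size-t ⟩
    n ∎
    where open ≡-Reasoning

  module Edge (o : ℕ) (l r : Tree) (f : Fits p o (node l r)) (end≤m : end o (node l r) ≤ m) where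
    q k rest : ℕ
    q = end (suc o) l
    k = size l
    rest = m ∸ suc q

    po : p o ≡ q
    po = proj₁ f

    pq : p q ≡ o
    pq = proj₁ (proj₂ f)

    fl : Fits p (suc o) l
    fl = proj₁ (proj₂ (proj₂ f))

    o<q : o < q
    o<q = start≤end (suc o) l

    q<m : q < m
    q<m = ≤-trans (In-upper (closing {o} {l} {r})) end≤m

    open Arcs m o q o<q q<m

    p-inside : ∀ {z} → Inside z → Inside (p z)
    p-inside (o<z , z<q) = let x = Fits-In fl (In-complete (suc o) l _ o<z z<q) in In-lower x , In-upper x

    p-outside : ∀ {z} → z < m → Outside z → Outside (p z)
    p-outside {z} z<m out with <-cmp (p z) o
    ... | tri< pz<o _ _ = inj₁ pz<o
    ... | tri≈ _ pz≡o _ = ⊥-elim (not-outside (≤-reflexive (sym z≡q)) out)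
      where
      z≡q : z ≡ q
      z≡q = trans (sym (involutive z<m)) (trans (cong p pz≡o) po)
      not-outside : q ≤ z → ¬ Outside z
      not-outside q≤z (inj₁ z<o) = <⇒≱ (<-trans z<o o<q) q≤z
      not-outside q≤z (inj₂ q<z) = <-irrefl (sym z≡q) q<z
    ... | tri> _ _ o<pz with <-cmp (p z) q
    ...   | tri> _ _ q<pz = inj₂ q<pz
    ...   | tri≈ _ pz≡q _ = ⊥-elim (not-outside out)
      where
      z≡o : z ≡ o
      z≡o = trans (sym (involutive z<m)) (trans (cong p pz≡q) pq)
      not-outside : ¬ Outside z
      not-outside (inj₁ z<o) = <-irrefl z≡o z<o
      not-outside (inj₂ q<z) = <-asym q<z (subst (_< q) (sym z≡o) o<q)
    ...   | tri< pz<q _ _ = ⊥-elim (not-outside (subst Inside (involutive z<m) (p-inside (o<pz , pz<q))) out)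
      where
      not-outside : Inside z → ¬ Outside z
      not-outside (o<z , z<q) (inj₁ z<o) = <-asym o<z z<o
      not-outside (o<z , z<q) (inj₂ q<z) = <-asym z<q q<z

    q≡ : q ≡ suc o + double k
    q≡ = end≡ (suc o) l

    m≡ : m ≡ suc q + rest
    m≡ = sym (m+[n∸m]≡n q<m)

    split : ∀ g → rangeSum 0 m g ≡
      rangeSum 0 o g + (g o + (rangeSum (suc o) (double k) g + (g q + rangeSum (suc q) rest g)))
    split g = begin
      rangeSum 0 m g
        ≡⟨ cong (λ j → rangeSum 0 j g) m-split ⟩
      rangeSum 0 (o + suc (double k + suc rest)) g
        ≡⟨ rangeSum-+ 0 o _ g ⟩
      rangeSum 0 o g + (g o + rangeSum (suc o) (double k + suc rest) g)
        ≡⟨ cong (λ x → rangeSum 0 o g + (g o + x)) (rangeSum-+ (suc o) (double k) (suc rest) g) ⟩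
      rangeSum 0 o g + (g o + (rangeSum (suc o) (double k) g + rangeSum (suc o + double k) (suc rest) g))
        ≡⟨ cong (λ x → rangeSum 0 o g + (g o + (rangeSum (suc o) (double k) g + rangeSum x (suc rest) g))) q≡ ⟨
      rangeSum 0 o g + (g o + (rangeSum (suc o) (double k) g + (g q + rangeSum (suc q) rest g))) ∎
      where
      open ≡-Reasoning
      arith : ∀ o k r → suc (suc o + k) + r ≡ o + suc (k + suc r)
      arith = ℕ-Solver.solve-∀
      m-split : m ≡ o + suc (double k + suc rest)
      m-split = trans m≡ (trans (cong (λ x → suc x + rest) q≡) (arith o (double k) rest))

    before-outside : ∀ {z} → z < 0 + o → z < m × Outside z
    before-outside z<o = <-trans z<o (<-trans o<q q<m) , inj₁ z<o

    after-outside : ∀ {z} → suc q ≤ z → z < suc q + rest → z < m × Outside z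
    after-outside q<z z<e = ≤-trans z<e (≤-reflexive (sym m≡)) , inj₂ q<z

    between-inside : ∀ {z} → suc o ≤ z → z < suc o + double k → Inside z
    between-inside o<z z<e = o<z , ≤-trans z<e (≤-reflexive (sym q≡))

    bit-false : ∀ a {b} c → b ≡ false → bit (a ∧ b ∧ c) ≡ 0
    bit-false a c refl = cong bit (∧-zeroʳ a)

    bit-true : ∀ a {b c} → b ≡ true → c ≡ true → bit (a ∧ b ∧ c) ≡ bit a
    bit-true a refl refl = cong bit (∧-identityʳ a)

    side-inner : side m p o q ≡ k
    side-inner = begin
      side m p o q
        ≡⟨ split g ⟩
      rangeSum 0 o g + (g o + (rangeSum (suc o) (double k) g + (g q + rangeSum (suc q) rest g)))
        ≡⟨ cong₂ _+_ (rangeSum-ε 0 o λ z _ z<o → bit-false (z <ᵇ p z) _ (arc-outside (proj₂ (before-outside z<o))))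
           (cong₂ _+_ (bit-false (o <ᵇ p o) _ (arc-start m o q))
           (cong₂ _+_ (rangeSum-cong (suc o) (double k) λ z o<z z<e → let in-z = between-inside o<z z<e in
                         bit-true (z <ᵇ p z) (arc-inside in-z) (arc-inside (p-inside in-z)))
           (cong₂ _+_ (bit-false (q <ᵇ p q) _ arc-end)
                      (rangeSum-ε (suc q) rest λ z q<z z<e →
                         bit-false (z <ᵇ p z) _ (arc-outside (proj₂ (after-outside q<z z<e))))))) ⟩
      rangeSum (suc o) (double k) (λ z → bit (z <ᵇ p z)) + 0
        ≡⟨ +-identityʳ _ ⟩
      rangeSum (suc o) (double k) (λ z → bit (z <ᵇ p z))
        ≡⟨ openings-size (suc o) l fl ⟩
      k ∎
      where
      open ≡-Reasoning
      g = λ z → bit (sideTerm m o q z (p z))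

    -- Adding the `k` inner edges and the edge itself to the outer side gives all openings. The
    -- additive form avoids writing the outer side as a truncated difference.
    side-outer : suc k + side m p q o ≡ n
    side-outer = begin
      suc k + side m p q o
        ≡⟨ cong (λ x → suc k + x) (split g) ⟩
      suc k + (rangeSum 0 o g + (g o + (rangeSum (suc o) (double k) g + (g q + rangeSum (suc q) rest g))))
        ≡⟨ cong (λ x → suc k + x)
           (cong₂ _+_ (rangeSum-cong 0 o λ z _ z<o → outer (before-outside z<o))
           (cong₂ _+_ (bit-false (o <ᵇ p o) _ (coarc-inside ≤-refl o<q))
           (cong₂ _+_ (rangeSum-ε (suc o) (double k) λ z o<z z<e →
                         bit-false (z <ᵇ p z) _ (coarc-inside (<⇒≤ o<z) (proj₂ (between-inside o<z z<e))))
           (cong₂ _+_ (bit-false (q <ᵇ p q) _ (arc-start m q o))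
                      (rangeSum-cong (suc q) rest λ z q<z z<e → outer (after-outside q<z z<e)))))) ⟩
      suc k + (rangeSum 0 o h + rangeSum (suc q) rest h)
        ≡⟨ arith k (rangeSum 0 o h) (rangeSum (suc q) rest h) ⟩
      rangeSum 0 o h + (1 + (k + (0 + rangeSum (suc q) rest h)))
        ≡⟨ cong₂ (λ x y → rangeSum 0 o h + (x + y)) (cong bit (trans (cong (o <ᵇ_) po) (<ᵇ-true o<q)))
           (cong₂ _+_ (openings-size (suc o) l fl)
             (cong (_+ rangeSum (suc q) rest h) (cong bit (trans (cong (q <ᵇ_) pq) (<ᵇ-false (<⇒≤ o<q)))))) ⟨
      rangeSum 0 o h + (h o + (rangeSum (suc o) (double k) h + (h q + rangeSum (suc q) rest h)))
        ≡⟨ split h ⟨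
      rangeSum 0 m h
        ≡⟨ openings-total ⟩
      n ∎
      where
      open ≡-Reasoning
      g = λ z → bit (sideTerm m q o z (p z))
      h = λ z → bit (z <ᵇ p z)
      outer : ∀ {z} → z < m × Outside z → g z ≡ h z
      outer {z} (z<m , out) = bit-true (z <ᵇ p z) (coarc-outside z<m out)
        (coarc-outside (bounded z<m) (p-outside z<m out))
      arith : ∀ k a b → suc k + (a + b) ≡ a + (1 + (k + (0 + b)))
      arith = ℕ-Solver.solve-∀

    -- The gap is odd while `n` is even, so it never equals `n`. The centre therefore lies strictly
    -- on one side of each edge, and which side depends only on whether `k` reaches `K`.
    gap-forward : gap m o q ≡ suc (double k)
    gap-forward = trans (gap-≤ m (<⇒≤ o<q))
      (trans (cong (_∸ o) (trans q≡ (sym (+-suc o (double k))))) (m+n∸m≡n o (suc (double k))))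

    gap-sum : gap m o q + gap m q o ≡ n + n
    gap-sum = begin
      gap m o q + gap m q o       ≡⟨ cong₂ _+_ (gap-≤ m (<⇒≤ o<q)) (gap-> m o<q) ⟩
      (q ∸ o) + ((m + o) ∸ q)     ≡⟨ +-cancelˡ-≡ o _ _ lemma ⟩
      m                           ≡⟨ trans m≡2n (double≡+ n) ⟩
      n + n                       ∎
      where
      open ≡-Reasoning
      lemma : o + ((q ∸ o) + ((m + o) ∸ q)) ≡ o + m
      lemma = begin
        o + ((q ∸ o) + ((m + o) ∸ q)) ≡⟨ +-assoc o (q ∸ o) _ ⟨
        (o + (q ∸ o)) + ((m + o) ∸ q) ≡⟨ cong (_+ ((m + o) ∸ q)) (m+[n∸m]≡n (<⇒≤ o<q)) ⟩
        q + ((m + o) ∸ q)             ≡⟨ m+[n∸m]≡n (≤-trans (<⇒≤ q<m) (m≤m+n m o)) ⟩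
        m + o                         ≡⟨ +-comm m o ⟩
        o + m                         ∎

    short-forward : k < K → gap m o q < n
    short-forward k<K = begin-strict
      gap m o q      ≡⟨ gap-forward ⟩
      suc (double k) <⟨ double-mono-≤ k<K ⟩
      double K       ≡⟨ double≡+ K ⟩
      K + K          ≡⟨ n≡2K ⟨
      n              ∎
      where open ≤-Reasoning

    short-backward : k < K → n ≤ gap m q o
    short-backward k<K = ≮⇒≥ λ back<n → <-irrefl gap-sum (+-mono-< (short-forward k<K) back<n)

    long-forward : K ≤ k → n < gap m o q
    long-forward K≤k = begin-strict
      n              ≡⟨ n≡2K ⟩
      K + K          ≡⟨ double≡+ K ⟨
      double K       ≤⟨ double-mono-≤ K≤k ⟩
      double k       <⟨ n<1+n (double k) ⟩
      suc (double k) ≡⟨ gap-forward ⟨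
      gap m o q      ∎
      where open ≤-Reasoning

    long-backward : K ≤ k → gap m q o < n
    long-backward K≤k = ≰⇒> λ n≤back → <-irrefl (sym gap-sum) (+-mono-<-≤ (long-forward K≤k) n≤back)

    short-min : k < K → side m p o q ⊓ side m p q o ≡ k
    short-min k<K = trans (cong (_⊓ side m p q o) side-inner)
      (m≤n⇒m⊓n≡m (+-cancelˡ-≤ (suc k) k (side m p q o) (begin
        suc k + k              ≤⟨ +-mono-≤ k<K (<⇒≤ k<K) ⟩
        K + K                  ≡⟨ n≡2K ⟨
        n                      ≡⟨ side-outer ⟨
        suc k + side m p q o   ∎)))
      where open ≤-Reasoning

    long-min : K ≤ k → side m p q o ⊓ side m p o q ≡ side m p q o
    long-min K≤k = m≤n⇒m⊓n≡m (+-cancelˡ-≤ (suc k) (side m p q o) (side m p o q) (begin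
      suc k + side m p q o   ≡⟨ side-outer ⟩
      n                      ≡⟨ n≡2K ⟩
      K + K                  ≤⟨ +-mono-≤ (m≤n⇒m≤1+n K≤k) K≤k ⟩
      suc k + k              ≡⟨ cong (λ x → suc k + x) side-inner ⟨
      suc k + side m p o q   ∎))
      where open ≤-Reasoning

-- Parity, signs and the summands of the weight.

odd? : ℕ → Bool
odd? zero    = false
odd? (suc n) = not (odd? n)

odd?-+double : ∀ a k → odd? (a + double k) ≡ odd? a
odd?-+double a zero    = cong odd? (+-identityʳ a)
odd?-+double a (suc k) rewrite +-suc a (suc (double k)) | +-suc a (double k) =
  trans (not-involutive _) (odd?-+double a k)

even-%2 : ∀ i → (i % 2 ≡ᵇ 0) ≡ not (odd? i)
even-%2 zero          = refl
even-%2 (suc zero)    = refl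
even-%2 (suc (suc i)) = trans (even-%2 i) (cong not (sym (not-involutive (odd? i))))

sign : Bool → ℤ
sign false = + 1
sign true  = -[1+ 0 ]

signAt : ℕ → ℤ
signAt i = if i % 2 ≡ᵇ 0 then + 1 else -[1+ 0 ]

signAt≡sign : ∀ i → signAt i ≡ sign (odd? i)
signAt≡sign i rewrite even-%2 i with odd? i
... | false = refl
... | true  = refl

weightTerm : (m n : ℕ) → (ℕ → ℕ) → ℕ → ℕ → ℤ
weightTerm m n p i j = if gap m i j <ᵇ n then signAt i ℤ.* + (side m p i j ⊓ side m p j i) else + 0

M₀Term : (m n : ℕ) → (ℕ → ℕ) → ℕ → ℕ → Bool
M₀Term m n p i j = not (gap m i j <ᵇ n) ∨ ((side m p i j ⊓ side m p j i ≡ᵇ 0) ∧ (i % 2 ≡ᵇ 0))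

len-side : ∀ {m} (v : Matching m) x → let i = toℕ x ; j = toℕ (lookup v x) in
  len v x ≡ side m (nth v) i j ⊓ side m (nth v) j i
len-side v x = cong₂ _⊓_ (edgesOnSide-side v x (lookup v x)) (edgesOnSide-side v (lookup v x) x)

weight-rangeSum : ∀ n (v : Matching (2 * n)) →
  weight n v ≡ ℤ-Range.rangeSum 0 (2 * n) (λ i → weightTerm (2 * n) n (nth v) i (nth v i))
weight-rangeSum n v = sumℤ-rangeSum _ λ x → trans
  (cong (λ L → if centerRight n v x then sgn x ℤ.* + L else + 0) (len-side v x))
  (cong (weightTerm (2 * n) n (nth v) (toℕ x)) (sym (nth-lookup v x)))

M₀Term-toℕ : ∀ n (v : Matching (2 * n)) x →
  (not (centerRight n v x) ∨ ((len v x ≡ᵇ 0) ∧ (toℕ x % 2 ≡ᵇ 0))) ≡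
  M₀Term (2 * n) n (nth v) (toℕ x) (nth v (toℕ x))
M₀Term-toℕ n v x = trans
  (cong (λ L → not (centerRight n v x) ∨ ((L ≡ᵇ 0) ∧ (toℕ x % 2 ≡ᵇ 0))) (len-side v x))
  (cong (M₀Term (2 * n) n (nth v) (toℕ x)) (sym (nth-lookup v x)))

isM₀⁻ : ∀ n (v : Matching (2 * n)) → T (isM₀ n v) →
  ∀ {i} → i < 2 * n → T (M₀Term (2 * n) n (nth v) i (nth v i))
isM₀⁻ n v h = forall-toℕ (λ i → T (M₀Term (2 * n) n (nth v) i (nth v i)))
  λ x → subst T (M₀Term-toℕ n v x) (allᶠ⁻ _ h x)

isM₀⁺ : ∀ n (v : Matching (2 * n)) → (∀ {i} → i < 2 * n → T (M₀Term (2 * n) n (nth v) i (nth v i))) →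
  T (isM₀ n v)
isM₀⁺ n v h = allᶠ⁺ _ λ x → subst T (sym (M₀Term-toℕ n v x)) (h (toℕ<n x))

M₀Term-short : ∀ m n p i j → gap m i j < n → T (M₀Term m n p i j) →
  side m p i j ⊓ side m p j i ≡ 0 × odd? i ≡ false
M₀Term-short m n p i j gap<n h rewrite <ᵇ-true gap<n | even-%2 i =
  let L≡0 , even = Equivalence.to T-∧ h
  in ≡ᵇ⇒≡ _ _ L≡0 , not-true⇒false (Equivalence.to T-≡ even)

M₀Term-long⁺ : ∀ m n p i j → n ≤ gap m i j → T (M₀Term m n p i j)
M₀Term-long⁺ m n p i j n≤gap rewrite <ᵇ-false n≤gap = tt

M₀Term-short⁺ : ∀ m n p i j → side m p i j ⊓ side m p j i ≡ 0 → odd? i ≡ false → T (M₀Term m n p i j)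
M₀Term-short⁺ m n p i j L≡0 even rewrite L≡0 | even-%2 i | even with gap m i j <ᵇ n
... | true  = tt
... | false = tt

module Weights (K n m : ℕ) (0<K : 0 < K) (n≡2K : n ≡ K + K) (m≡2n : m ≡ double n)
               {p : ℕ → ℕ} (t : Tree) (fits : Fits p 0 t) (size-t : size t ≡ n) where
  open Long K 0<K
  open Edges K n m 0<K n≡2K m≡2n t fits size-t
  open ℤ-Range using () renaming (treeSum to treeSumℤ)

  end-t : end 0 t ≡ m
  end-t = trans (end≡ 0 t) (trans (cong double size-t) (sym m≡2n))

  term : ℕ → ℕ → ℤ
  term = weightTerm m n p

  longSize : ℕ → ℤ
  longSize k = if K ≤ᵇ k then + (n ∸ 1) else + 0

  longWeight : Tree → ℤ
  longWeight u = if longOdd u then + (n ∸ 1) else + 0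

  longOdd-small : ∀ u → size u ≤ K → longOdd u ≡ false
  longOdd-small leaf       _    = refl
  longOdd-small (node l r) lr<K = trans
    (longOdd-short l r (≤-trans (s≤s (m≤m+n (size l) (size r))) lr<K))
    (longOdd-small r (≤-trans (m≤n+m (size r) (size l)) (<⇒≤ lr<K)))

  longWeight-small : ∀ u → size u ≤ K → longWeight u ≡ + 0
  longWeight-small u u≤K rewrite longOdd-small u u≤K = refl

  -- At most one of the subtrees contains long edges: a short `l` has none, and next to a long `l`
  -- the tree `r` is too small. The minus sign reproduces the change of parity in `longOdd`.
  longWeight-node : ∀ l r → size (node l r) ≤ K + K →
    longWeight (node l r) ≡ longSize (size l) ℤ.- longWeight l ℤ.+ longWeight r
  longWeight-node l r lr<2K with <-≤-connex (size l) K
  ... | inj₁ l<K rewrite longOdd-short l r l<K | ≤ᵇ-false l<K | longWeight-small l (<⇒≤ l<K) =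
    sym (ℤₚ.+-identityˡ _)
  ... | inj₂ K≤l rewrite longOdd-long l r K≤l | ≤ᵇ-true K≤l
                       | longWeight-small r (+-cancelˡ-≤ K (size r) K
                           (≤-trans (+-monoˡ-≤ (size r) K≤l) (<⇒≤ lr<2K))) with longOdd l
  ...   | false = sym (trans (ℤₚ.+-identityʳ _) (ℤₚ.+-identityʳ _))
  ...   | true  = sym (trans (ℤₚ.+-identityʳ _) (ℤₚ.+-inverseʳ (+ (n ∸ 1))))

  term-short : ∀ i j → gap m i j < n → term i j ≡ signAt i ℤ.* + (side m p i j ⊓ side m p j i)
  term-short i j g<n rewrite <ᵇ-true g<n = refl

  term-long : ∀ i j → n ≤ gap m i j → term i j ≡ + 0
  term-long i j n≤g rewrite <ᵇ-false n≤g = refl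

  module _ (o : ℕ) (l r : Tree) (f : Fits p o (node l r)) (end≤m : end o (node l r) ≤ m) where
    open Edge o l r f end≤m

    odd?-q : odd? q ≡ not (odd? o)
    odd?-q = trans (cong odd? q≡) (odd?-+double (suc o) k)

    signAt-q : signAt q ≡ ℤ.- sign (odd? o)
    signAt-q = trans (signAt≡sign q) (trans (cong sign odd?-q) (sign-not (odd? o)))
      where
      sign-not : ∀ b → sign (not b) ≡ ℤ.- sign b
      sign-not false = refl
      sign-not true  = refl

    -- A short edge is oriented from `o` and has length `k`. A long one is oriented from `q`, which
    -- has the opposite parity, and has length `n - 1 - k`; two sign changes turn its contribution
    -- into that of a short edge corrected by `n - 1`.
    edge-weight : term o q ℤ.+ term q o ≡ sign (odd? o) ℤ.* (+ k ℤ.- longSize k)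
    edge-weight with <-≤-connex k K
    ... | inj₁ k<K rewrite ≤ᵇ-false k<K = begin
      term o q ℤ.+ term q o
        ≡⟨ cong₂ ℤ._+_ (term-short o q (short-forward k<K)) (term-long q o (short-backward k<K)) ⟩
      signAt o ℤ.* + (side m p o q ⊓ side m p q o) ℤ.+ + 0
        ≡⟨ ℤₚ.+-identityʳ _ ⟩
      signAt o ℤ.* + (side m p o q ⊓ side m p q o)
        ≡⟨ cong₂ (λ s x → s ℤ.* + x) (signAt≡sign o) (short-min k<K) ⟩
      sign (odd? o) ℤ.* + k
        ≡⟨ cong (sign (odd? o) ℤ.*_) (ℤₚ.+-identityʳ (+ k)) ⟨
      sign (odd? o) ℤ.* (+ k ℤ.- + 0) ∎
      where open ≡-Reasoning
    ... | inj₂ K≤k rewrite ≤ᵇ-true K≤k = begin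
      term o q ℤ.+ term q o
        ≡⟨ cong₂ ℤ._+_ (term-long o q (<⇒≤ (long-forward K≤k))) (term-short q o (long-backward K≤k)) ⟩
      + 0 ℤ.+ signAt q ℤ.* + (side m p q o ⊓ side m p o q)
        ≡⟨ cong₂ (λ s x → + 0 ℤ.+ s ℤ.* + x) signAt-q (long-min K≤k) ⟩
      + 0 ℤ.+ (ℤ.- sign (odd? o)) ℤ.* + side m p q o
        ≡⟨ lemma (sign (odd? o)) (+ k) (+ side m p q o) ⟩
      sign (odd? o) ℤ.* (+ k ℤ.- + (k + side m p q o))
        ≡⟨ cong (λ x → sign (odd? o) ℤ.* (+ k ℤ.- + (x ∸ 1))) side-outer ⟩
      sign (odd? o) ℤ.* (+ k ℤ.- + (n ∸ 1)) ∎
      where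
      open ≡-Reasoning
      lemma : ∀ s k b → + 0 ℤ.+ (ℤ.- s) ℤ.* b ≡ s ℤ.* (k ℤ.- (k ℤ.+ b))
      lemma = ℤ-Solver.solve-∀

    -- A short edge starting at an odd position is negative. A long one of length 0 encloses all
    -- other edges, so it would have to start at position 0; otherwise its right end would lie
    -- beyond the last point.
    M₀-odd-absurd : odd? o ≡ true → 0 < o →
      T (M₀Term m n p o (p o)) → T (M₀Term m n p q (p q)) → ⊥
    M₀-odd-absurd odd 0<o hₒ h_q with <-≤-connex k K
    ... | inj₁ k<K = case trans (sym odd) (proj₂ (M₀Term-short m n p o q (short-forward k<K)
                       (subst (λ j → T (M₀Term m n p o j)) po hₒ))) of λ ()
    ... | inj₂ K≤k = <⇒≱ q<m (begin
      m                        ≡⟨ m≡2n ⟩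
      double n                 ≡⟨ cong double side-outer ⟨
      double (suc k + side m p q o) ≡⟨ cong (λ x → double (suc k + x)) outer≡0 ⟩
      double (suc k + 0)       ≡⟨ cong double (+-identityʳ (suc k)) ⟩
      2 + double k             ≤⟨ +-monoˡ-≤ (double k) (s≤s 0<o) ⟩
      suc o + double k         ≡⟨ q≡ ⟨
      q                        ∎)
      where
      open ≤-Reasoning
      outer≡0 : side m p q o ≡ 0
      outer≡0 = trans (sym (long-min K≤k)) (proj₁ (M₀Term-short m n p q o (long-backward K≤k)
                  (subst (λ j → T (M₀Term m n p q j)) pq h_q)))

    M₀-opening : k ≡ 0 → odd? o ≡ false → T (M₀Term m n p o (p o))
    M₀-opening k≡0 even = subst (λ j → T (M₀Term m n p o j)) (sym po)
      (M₀Term-short⁺ m n p o q (trans (short-min (subst (_< K) (sym k≡0) 0<K)) k≡0) even)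

    M₀-closing : k ≡ 0 → T (M₀Term m n p q (p q))
    M₀-closing k≡0 = subst (λ j → T (M₀Term m n p q j)) (sym pq)
      (M₀Term-long⁺ m n p q o (short-backward (subst (_< K) (sym k≡0) 0<K)))

  -- The weight of the edges of u if its first point has the given parity. Up to the
  -- long edges: an edge is counted once, with alternating signs, by every edge
  -- enclosing it, so only the edges at odd nesting depth contribute.
  value : Bool → Tree → ℤ
  value false u = + oddEdges false u ℤ.- longWeight u
  value true  u = + oddEdges true u ℤ.- + size u ℤ.+ longWeight u

  value-node : ∀ b l r → size (node l r) ≤ K + K →
    sign b ℤ.* (+ size l ℤ.- longSize (size l)) ℤ.+ (value (not b) l ℤ.+ value b r) ≡ value b (node l r)
  value-node false l r lr≤2K = trans
    (lemma (+ size l) (longSize (size l)) (+ oddEdges true l) (+ oddEdges false r) (longWeight l) (longWeight r))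
    (cong (λ x → + oddEdges true l ℤ.+ + oddEdges false r ℤ.- x) (sym (longWeight-node l r lr≤2K)))
    where
    lemma : ∀ s L a b x y →
      + 1 ℤ.* (s ℤ.- L) ℤ.+ ((a ℤ.- s ℤ.+ x) ℤ.+ (b ℤ.- y)) ≡ a ℤ.+ b ℤ.- (L ℤ.- x ℤ.+ y)
    lemma = ℤ-Solver.solve-∀
  value-node true l r lr≤2K = trans
    (lemma (+ size l) (+ size r) (longSize (size l)) (+ oddEdges false l) (+ oddEdges true r) (longWeight l) (longWeight r))
    (cong (λ x → + 1 ℤ.+ (+ oddEdges false l ℤ.+ + oddEdges true r) ℤ.- (+ 1 ℤ.+ (+ size l ℤ.+ + size r)) ℤ.+ x)
      (sym (longWeight-node l r lr≤2K)))
    where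
    lemma : ∀ s s′ L a b x y →
      ℤ.- + 1 ℤ.* (s ℤ.- L) ℤ.+ ((a ℤ.- x) ℤ.+ (b ℤ.- s′ ℤ.+ y)) ≡
      + 1 ℤ.+ (a ℤ.+ b) ℤ.- (+ 1 ℤ.+ (s ℤ.+ s′)) ℤ.+ (L ℤ.- x ℤ.+ y)
    lemma = ℤ-Solver.solve-∀

  treeSum-value : ∀ o u → Fits p o u → end o u ≤ m → size u ≤ K + K → treeSumℤ term o u ≡ value (odd? o) u
  treeSum-value o leaf _ _ _ with odd? o
  ... | false = refl
  ... | true  = refl
  treeSum-value o (node l r) f@(_ , _ , fl , fr) end≤m lr≤2K = begin
    term o q ℤ.+ (treeSumℤ term (suc o) l ℤ.+ (term q o ℤ.+ treeSumℤ term (suc q) r))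
      ≡⟨ cong₂ (λ x y → term o q ℤ.+ (x ℤ.+ (term q o ℤ.+ y)))
           (treeSum-value (suc o) l fl (≤-trans (<⇒≤ (In-upper (closing {o} {l} {r}))) end≤m)
             (≤-trans (m≤m+n (size l) (size r)) (<⇒≤ lr≤2K)))
           (treeSum-value (suc q) r fr end≤m (≤-trans (m≤n+m (size r) (size l)) (<⇒≤ lr≤2K))) ⟩
    term o q ℤ.+ (value (not (odd? o)) l ℤ.+ (term q o ℤ.+ value (odd? (suc q)) r))
      ≡⟨ cong (λ b → term o q ℤ.+ (value (not (odd? o)) l ℤ.+ (term q o ℤ.+ value b r)))
           (trans (cong not (odd?-q o l r f end≤m)) (not-involutive (odd? o))) ⟩
    term o q ℤ.+ (value (not (odd? o)) l ℤ.+ (term q o ℤ.+ value (odd? o) r))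
      ≡⟨ lemma (term o q) (value (not (odd? o)) l) (term q o) (value (odd? o) r) ⟩
    (term o q ℤ.+ term q o) ℤ.+ (value (not (odd? o)) l ℤ.+ value (odd? o) r)
      ≡⟨ cong (ℤ._+ (value (not (odd? o)) l ℤ.+ value (odd? o) r)) (edge-weight o l r f end≤m) ⟩
    sign (odd? o) ℤ.* (+ size l ℤ.- longSize (size l)) ℤ.+ (value (not (odd? o)) l ℤ.+ value (odd? o) r)
      ≡⟨ value-node (odd? o) l r lr≤2K ⟩
    value (odd? o) (node l r) ∎
    where
    open ≡-Reasoning
    q = end (suc o) l
    lemma : ∀ a b c d → a ℤ.+ (b ℤ.+ (c ℤ.+ d)) ≡ (a ℤ.+ c) ℤ.+ (b ℤ.+ d)
    lemma = ℤ-Solver.solve-∀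

  total-weight : ℤ-Range.rangeSum 0 m (λ i → term i (p i)) ≡ + oddEdges false t ℤ.- longWeight t
  total-weight = begin
    ℤ-Range.rangeSum 0 m (λ i → term i (p i))
      ≡⟨ cong (λ k → ℤ-Range.rangeSum 0 k (λ i → term i (p i))) (trans m≡2n (cong double (sym size-t))) ⟩
    ℤ-Range.rangeSum 0 (double (size t)) (λ i → term i (p i))
      ≡⟨ ℤ-Range.rangeSum-Fits term 0 t fits ⟩
    treeSumℤ term 0 t
      ≡⟨ treeSum-value 0 t fits (≤-reflexive end-t) (≤-reflexive (trans size-t n≡2K)) ⟩
    + oddEdges false t ℤ.- longWeight t ∎
    where open ≡-Reasoning

  -- If the number of long edges is odd, the weight is b - (n - 1). This is at most 0, because the
  -- first edge starts at the even position 0 and so b ≤ n - 1.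
  weight⁻ : ∀ c → 0 < c → + oddEdges false t ℤ.- longWeight t ≡ + c →
    oddEdges false t ≡ c × longOdd t ≡ false
  weight⁻ c 0<c e with longOdd t
  ... | false = ℤₚ.+-injective (trans (sym (ℤₚ.+-identityʳ _)) e) , refl
  ... | true  = contradiction oddEdges<n (<⇒≱ (begin-strict
      n ∸ 1                <⟨ m<n+m (n ∸ 1) 0<c ⟩
      c + (n ∸ 1)          ≡⟨ ℤₚ.+-injective oddEdges≡ ⟨
      oddEdges false t     ∎))
    where
    open ≤-Reasoning
    oddEdges≡ : + oddEdges false t ≡ + (c + (n ∸ 1))
    oddEdges≡ = trans (lemma (+ oddEdges false t) (+ (n ∸ 1))) (cong (ℤ._+ + (n ∸ 1)) e)
      where
      lemma : ∀ x y → x ≡ x ℤ.- y ℤ.+ y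
      lemma = ℤ-Solver.solve-∀
    oddEdges<n : oddEdges false t ≤ n ∸ 1
    oddEdges<n = ≤-trans (bound t) (≤-reflexive (cong (_∸ 1) size-t))
      where
      bound : ∀ u → oddEdges false u ≤ size u ∸ 1
      bound leaf       = z≤n
      bound (node l r) = +-mono-≤ (oddEdges≤size true l) (oddEdges≤size false r)

  weight⁺ : ∀ c → oddEdges false t ≡ c → longOdd t ≡ false → + oddEdges false t ℤ.- longWeight t ≡ + c
  weight⁺ c refl even rewrite even = ℤₚ.+-identityʳ _

  -- A nonempty left subtree would begin with an edge at an odd position, which `M₀-odd-absurd`
  -- excludes. Every first edge is thus `()`, and the tree has neither odd nor long edges.
  M₀⁻ : (∀ {i} → i < m → T (M₀Term m n p i (p i))) → oddEdges false t ≡ 0 × longOdd t ≡ false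
  M₀⁻ h = go 0 t fits (≤-reflexive end-t) refl (λ x → h (≤-trans (In-upper x) (≤-reflexive end-t)))
    where
    go : ∀ o u → Fits p o u → end o u ≤ m → odd? o ≡ false →
      (∀ {i} → In o u i → T (M₀Term m n p i (p i))) → oddEdges false u ≡ 0 × longOdd u ≡ false
    go o leaf _ _ _ _ = refl , refl
    go o (node leaf r) (_ , _ , _ , fr) end≤m even h =
      let odd≡0 , long = go (suc (suc o)) r fr end≤m (trans (not-involutive _) even) (λ x → h (after x))
      in odd≡0 , trans (longOdd-short leaf r 0<K) long
    go o (node l@(node l′ r′) r) (_ , _ , fl , _) end≤m even h = ⊥-elim
      (M₀-odd-absurd (suc o) l′ r′ fl (≤-trans (<⇒≤ (In-upper (closing {o} {l} {r}))) end≤m)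
        (cong not even) (s≤s z≤n) (h (inner opening)) (h (inner closing)))

  -- The first edge of a nonempty left subtree would be odd, so the tree is a sequence of edges
  -- `()`, each starting at an even position.
  M₀⁺ : oddEdges false t ≡ 0 → ∀ {i} → i < m → T (M₀Term m n p i (p i))
  M₀⁺ odd≡0 i<m = go 0 t fits (≤-reflexive end-t) refl odd≡0
      (In-complete 0 t _ z≤n (≤-trans i<m (≤-reflexive (sym end-t))))
    where
    go : ∀ o u → Fits p o u → end o u ≤ m → odd? o ≡ false → oddEdges false u ≡ 0 →
      ∀ {i} → In o u i → T (M₀Term m n p i (p i))
    go o (node leaf r) f end≤m even odd≡0 opening = M₀-opening o leaf r f end≤m refl even
    go o (node leaf r) f end≤m even odd≡0 closing = M₀-closing o leaf r f end≤m refl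
    go o (node leaf r) (_ , _ , _ , fr) end≤m even odd≡0 (after x) =
      go (suc (suc o)) r fr end≤m (trans (not-involutive _) even) odd≡0 x

does⁻ : {A : Set} (a? : Dec A) → T (does a?) → A
does⁻ (yes a) _ = a

double-injective : ∀ a b → double a ≡ double b → a ≡ b
double-injective zero    zero    _ = refl
double-injective (suc a) (suc b) e = cong suc (double-injective a b (suc-injective (suc-injective e)))

-- The bijection between matchings of prescribed weight and trees.

module _ (K n : ℕ) (0<K : 0 < K) (n≡2K : n ≡ K + K) where
  open Long K 0<K

  2*n≡double : 2 * n ≡ double n
  2*n≡double = trans (cong (λ x → n + x) (+-identityʳ n)) (sym (double≡+ n))

  isWeight : ℕ → Matching (2 * n) → Bool
  isWeight c v = if c ≡ᵇ 0 then isM₀ n v else does (weight n v ℤ.≟ + c)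

  isWeight⁻ : ∀ c v t → Fits (nth v) 0 t → size t ≡ n → T (isWeight c v) →
    oddEdges false t ≡ c × longOdd t ≡ false
  isWeight⁻ zero v t fits size-t h = M₀⁻ (isM₀⁻ n v h)
    where open Weights K n (2 * n) 0<K n≡2K 2*n≡double t fits size-t
  isWeight⁻ (suc c) v t fits size-t h =
    weight⁻ (suc c) (s≤s z≤n) (trans (sym total-weight) (trans (sym (weight-rangeSum n v)) (does⁻ (weight n v ℤ.≟ + suc c) h)))
    where open Weights K n (2 * n) 0<K n≡2K 2*n≡double t fits size-t

  isWeight⁺ : ∀ c v t → Fits (nth v) 0 t → size t ≡ n →
    oddEdges false t ≡ c → longOdd t ≡ false → T (isWeight c v)
  isWeight⁺ zero v t fits size-t odd≡c even = isM₀⁺ n v (M₀⁺ odd≡c)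
    where open Weights K n (2 * n) 0<K n≡2K 2*n≡double t fits size-t
  isWeight⁺ (suc c) v t fits size-t odd≡c even =
    Equivalence.from T-≡ (dec-true (weight n v ℤ.≟ + suc c)
      (trans (weight-rangeSum n v) (trans total-weight (weight⁺ (suc c) odd≡c even))))
    where open Weights K n (2 * n) 0<K n≡2K 2*n≡double t fits size-t

  end-size : ∀ t → size t ≡ n → end 0 t ≡ 2 * n
  end-size t size-t = trans (end≡ 0 t) (trans (cong double size-t) (sym 2*n≡double))

  matchings-↔-trees : ∀ c → Σ (Matching (2 * n)) (λ v → T (isW n c v)) ↔
                            Σ Tree (λ t → TreeClass n c t × longOdd t ≡ false)
  matchings-↔-trees c = relation-↔ (λ v t → Fits (nth v) 0 t × size t ≡ n)
    (λ _ → T-irrelevant) (λ t → ×-irrelevant (TreeClass-irrelevant n c t) ≡-irrelevant)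
    toTree toMatching
    (λ v t t′ _ _ (fits , size-t) (fits′ , size-t′) →
      Fits-unique t t′ fits fits′ (trans (end-size t size-t) (sym (end-size t′ size-t′))))
    (λ v v′ t _ _ (fits , size-t) (fits′ , _) → nth-injective v v′ λ i<2n →
      Fits-agree fits fits′ (In-complete 0 t _ z≤n (≤-trans i<2n (≤-reflexive (sym (end-size t size-t))))))
    where
    toTree : ∀ v → T (isW n c v) →
      Σ Tree λ t → (TreeClass n c t × longOdd t ≡ false) × (Fits (nth v) 0 t × size t ≡ n)
    toTree v h =
      let perfect , h′ = Equivalence.to T-∧ h
          noncrossing , h″ = Equivalence.to T-∧ h′
          t , fits , end-t = NoncrossingMatching⇒Fits (isMatching⇒NoncrossingMatching v perfect noncrossing)
          size-t = double-injective (size t) n (trans (sym (end≡ 0 t)) (trans end-t 2*n≡double))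
          odd≡c , even = isWeight⁻ c v t fits size-t h″
      in t , ((size-t , odd≡c) , even) , (fits , size-t)

    toMatching : ∀ t → TreeClass n c t × longOdd t ≡ false →
      Σ (Matching (2 * n)) λ v → T (isW n c v) × (Fits (nth v) 0 t × size t ≡ n)
    toMatching t ((size-t , odd≡c) , even) =
      let end-t = end-size t size-t
          M = subst (λ m → NoncrossingMatching m (mate 0 t)) end-t (Fits⇒NoncrossingMatching t (mate-Fits 0 t))
          v , nth-v = tabulate-nth (mate 0 t) (NoncrossingMatching.bounded M)
          fits = Fits-cong t (λ i x → sym (nth-v (≤-trans (In-upper x) (≤-reflexive end-t)))) (mate-Fits 0 t)
          perfect , noncrossing = NoncrossingMatching⇒isMatching v
            (subst (λ m → NoncrossingMatching m (nth v)) end-t (Fits⇒NoncrossingMatching t fits))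
      in v , Equivalence.from T-∧ (perfect , Equivalence.from T-∧
               (noncrossing , isWeight⁺ c v t fits size-t odd≡c even)) , (fits , size-t)

theorem16 : ∀ (n : ℕ) → 2 ≤ n → 2 ∣ n → ∀ (c : ℕ) → c ≤ n ∸ 2 →
    Σ ℕ (λ w → (Fin w ↔ Σ (Matching (2 * n)) (λ v → T (isW n c v)))
    × ((+ w) / 1 ≡ N 1 n (suc c) *ℚ ½))
theorem16 n@(suc (suc M)) (s≤s (s≤s _)) (divides K n≡K*2) c c≤M =
  -- The count is parametrised by e = n - 2 - c, a natural number by the bound on `c`, so that `n`
  -- is the sum 2 + e + c and the absorption laws involve no truncated subtraction.
  let w , size-w , w-formula = longEven-count (M ∸ c) c (trans n≡ n≡2K)
      size-w′ = subst (λ n → Σ Tree (λ t → TreeClass n c t × longOdd t ≡ false) HasSize w) n≡ size-w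
      w-formula′ = subst (λ M → (3 + M) * w ≡ ((3 + M) C suc c) * (M C c)) M≡ w-formula
  in w , ↔-trans size-w′ (↔-sym (matchings-↔-trees K n 0<K n≡2K c)) , N₁-half n c w w-formula′
  where
  0<K : 0 < K
  0<K = n≢0⇒n>0 λ { refl → case n≡K*2 of λ () }

  n≡2K : n ≡ K + K
  n≡2K = trans n≡K*2 (trans (*-comm K 2) (cong (λ x → K + x) (+-identityʳ K)))

  M≡ : M ∸ c + c ≡ M
  M≡ = m∸n+n≡m c≤M

  n≡ : suc (suc (M ∸ c + c)) ≡ n
  n≡ = cong (λ x → suc (suc x)) M≡

  open Long K 0<K
  open LongEven K 0<K
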